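{- For all integers $k,l,m$ with $3\le k<l$ and $l+\frac{k-1}{2}<m<k+l-1$, $r(k,l,m)=2k+2l-3$.
   Context: For a graph whose edges are coloured with red, blue and green, a red (resp. blue, green) $t$-connected matching is a connected component of the spanning subgraph formed by the red (resp. blue, green) edges whose maximum matching has size at least $t$. For positive integers $k,l,m$, $r(k,l,m)$ denotes the smallest integer $n$ such that every red-blue-green colouring of the edges of $K_{n,n}$ contains a red $k$-connected matching, or a blue $l$-connected matching, or a green $m$-connected matching. -}

module Defs where

open import Data.Nat using (ℕ; _+_; _*_; _∸_; _≤_; _<_)
open import Data.Fin using (Fin)
open import Data.Sum using (_⊎_; inj₁; inj₂)
open import Data.Product using (Σ; _×_; ∃)
open import Function.Definitions using (Injective)
open import Relation.Binary.PropositionalEquality using (_≡_)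
open import Relation.Binary.Construct.Closure.ReflexiveTransitive using (Star)
open import Relation.Nullary using (¬_)

data Colour : Set where
  red blue green : Colour

-- a red-blue-green edge colouring of K_{n,n}:
-- left vertex i and right vertex j are joined by an edge of colour col i j
Colouring : ℕ → Set
Colouring n = Fin n → Fin n → Colour

Vertex : ℕ → Set
Vertex n = Fin n ⊎ Fin n

data Adj {n : ℕ} (col : Colouring n) (c : Colour) : Vertex n → Vertex n → Set where
  lr : ∀ {i j} → col i j ≡ c → Adj col c (inj₁ i) (inj₂ j)
  rl : ∀ {i j} → col i j ≡ c → Adj col c (inj₂ j) (inj₁ i)

Connected : ∀ {n} → Colouring n → Colour → Vertex n → Vertex n → Set
Connected col c = Star (Adj col c)

-- a colour-c t-connected matching: a connected component of the colour-c
-- spanning subgraph with a matching of size (at least) t, i.e. t pairwise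
-- disjoint colour-c edges (left ends f i, right ends g i), all lying in one
-- connected component of the colour-c subgraph.
HasConnMatching : ∀ {n} → Colouring n → Colour → ℕ → Set
HasConnMatching {n} col c t =
  Σ (Fin t → Fin n) λ f → Σ (Fin t → Fin n) λ g →
    Injective _≡_ _≡_ f × Injective _≡_ _≡_ g ×
    (∀ i → col (f i) (g i) ≡ c) ×
    (∀ i j → Connected col c (inj₁ (f i)) (inj₁ (f j)))

RamseyProp : ℕ → ℕ → ℕ → ℕ → Set
RamseyProp k l m n = (col : Colouring n) →
  HasConnMatching col red k ⊎ HasConnMatching col blue l ⊎ HasConnMatching col green m

IsR : ℕ → ℕ → ℕ → ℕ → Set
IsR k l m N = RamseyProp k l m N × (∀ n → n < N → ¬ RamseyProp k l m n)

{-# OPTIONS --safe #-}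

-- Upper bound. Put p = k − 1, q = l − 1, n = 2(p + q) + 1 and forbid connected matchings of
-- sizes p + 1, q + 1, p + q + 1. König's theorem, localised to components, gives for each
-- colour a vertex cover with at most p, q, p + q vertices in each component. Since n exceeds
-- the sum of the three bounds, every vertex lies in one of the covers. The "free" vertices,
-- those outside the green cover, span no green edge, number at least n, and each is in the red
-- or the blue cover. A red/blue coloured complete bipartite graph has its component labels
-- concentrated on a line or in a 2 × 2 pattern; counting cover vertices rules out everything
-- except the situation where the free vertices of one side all lie in the cover of a single
-- red (or blue) component. There the remaining vertices of that side split into two green
-- components, and some vertex of the other side escapes the four red and blue components
-- attached to these; its edges then overload the covers.
--
-- Lower bound. On 2(p + q) vertices per side take left blocks of sizes m − 1, m − 1, ≤ p and
-- right blocks of sizes q, q, p, p, coloured by a table in which each colour meets each left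
-- block in one component, covered by a single block that is small enough.
module Submission where

open import Defs
open import Data.Bool using (if_then_else_)
open import Data.Empty using (⊥; ⊥-elim)
open import Data.Fin using (Fin; zero; suc)
import Data.Fin as Fin
import Data.Fin.Properties as Fin
open import Data.List using (List; []; _∷_; allFin; cartesianProduct)
open import Data.List.Membership.Propositional using (_∈_)
open import Data.List.Membership.Propositional.Properties using (∈-allFin; ∈-cartesianProduct⁺)
open import Data.List.Relation.Unary.Any using (here; there)
open import Data.Nat using (ℕ; zero; suc; _+_; _*_; _∸_; _≤_; _<_; z≤n; s≤s; _≤?_; _<?_)
open import Data.Nat.Properties
open import Data.Nat.Tactic.RingSolver using (solve)
open import Data.Product using (Σ; ∃; _×_; _,_; proj₁; proj₂; map₂; swap)
open import Data.Sum using (_⊎_; inj₁; inj₂; [_,_]′)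
import Data.Sum as Sum
import Data.Sum.Properties as Sum
open import Data.Unit using (⊤; tt)
open import Function using (_∘_; id; case_of_)
open import Function.Definitions using (Injective)
open import Level using (0ℓ)
open import Relation.Binary using (DecidableEquality; Symmetric)
open import Relation.Binary.Construct.Closure.ReflexiveTransitive using (ε; _◅_; _◅◅_)
open import Relation.Binary.PropositionalEquality
open import Relation.Nullary using (¬_; Dec; does; yes; no; ¬?; _×-dec_; contradiction)
open import Relation.Nullary.Decidable using (decidable-stable; toSum)
open import Relation.Unary using (Pred; Decidable; _∪_; ∁)
open import Relation.Unary.Properties using (_∩?_; _∪?_; ∁?; ∅?; U?)

infixr 6 _⊕_
_⊕_ : ∀ {a b c d} → a ≤ b → c ≤ d → a + c ≤ b + d
_⊕_ = +-mono-≤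

-- Closes a counting argument: the hypotheses are added up to `a ≤ b`, and the ring solver shows
-- that `a` exceeds `b` by `k + 1`.
clash : ∀ {a b} k → a ≤ b → a ≡ suc b + k → ⊥
clash {b = b} k a≤b refl = m+1+n≰m b (≤-trans (≤-reflexive (+-suc b k)) a≤b)

-- Cardinalities of decidable subsets of a finite type.

𝟙 : {P : Set} → Dec P → ℕ
𝟙 P? = if does P? then 1 else 0

# : ∀ {n} {P : Pred (Fin n) 0ℓ} → Decidable P → ℕ
# {zero}  P? = 0
# {suc n} P? = 𝟙 (P? zero) + # (P? ∘ suc)

-- The germ of the counting lemmas: summed over all points, with empty or full predicates in some
-- places, it yields monotonicity, subadditivity, the modular inequality and the complement bounds.
𝟙-sum : {P Q R S : Set} (P? : Dec P) (Q? : Dec Q) (R? : Dec R) (S? : Dec S) →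
  (P ⊎ Q → R ⊎ S) → (P × Q → R × S) → 𝟙 P? + 𝟙 Q? ≤ 𝟙 R? + 𝟙 S?
𝟙-sum (yes p) (yes q) (yes _) (yes _) _ _ = ≤-refl
𝟙-sum (yes p) (yes q) (yes _) (no ¬s) _ g = contradiction (proj₂ (g (p , q))) ¬s
𝟙-sum (yes p) (yes q) (no ¬r) _ _ g = contradiction (proj₁ (g (p , q))) ¬r
𝟙-sum (yes p) (no _) (yes _) _ _ _ = s≤s z≤n
𝟙-sum (yes p) (no _) (no _) (yes _) _ _ = ≤-refl
𝟙-sum (yes p) (no _) (no ¬r) (no ¬s) f _ = ⊥-elim ([ ¬r , ¬s ]′ (f (inj₁ p)))
𝟙-sum (no _) (yes q) (yes _) _ _ _ = s≤s z≤n
𝟙-sum (no _) (yes q) (no _) (yes _) _ _ = ≤-refl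
𝟙-sum (no _) (yes q) (no ¬r) (no ¬s) f _ = ⊥-elim ([ ¬r , ¬s ]′ (f (inj₂ q)))
𝟙-sum (no _) (no _) _ _ _ _ = z≤n

#-sum : ∀ {n} {P Q R S : Pred (Fin n) 0ℓ}
  (P? : Decidable P) (Q? : Decidable Q) (R? : Decidable R) (S? : Decidable S) →
  (∀ i → P i ⊎ Q i → R i ⊎ S i) → (∀ i → P i × Q i → R i × S i) →
  # P? + # Q? ≤ # R? + # S?
#-sum {zero} _ _ _ _ _ _ = z≤n
#-sum {suc n} P? Q? R? S? f g =
  subst₂ _≤_ (rearrange (𝟙 (P? zero)) (𝟙 (Q? zero)) (# (P? ∘ suc)) (# (Q? ∘ suc)))
             (rearrange (𝟙 (R? zero)) (𝟙 (S? zero)) (# (R? ∘ suc)) (# (S? ∘ suc)))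
    (𝟙-sum (P? zero) (Q? zero) (R? zero) (S? zero) (f zero) (g zero)
      ⊕ #-sum (P? ∘ suc) (Q? ∘ suc) (R? ∘ suc) (S? ∘ suc) (f ∘ suc) (g ∘ suc))
  where
  rearrange : ∀ a b c d → a + b + (c + d) ≡ a + c + (b + d)
  rearrange a b c d = solve (a ∷ b ∷ c ∷ d ∷ [])

#-none : ∀ {n} → # {n} ∅? ≡ 0
#-none {zero}  = refl
#-none {suc n} = #-none {n}

#-all : ∀ {n} → # {n} U? ≡ n
#-all {zero}  = refl
#-all {suc n} = cong suc (#-all {n})

module _ {n : ℕ} {P Q : Pred (Fin n) 0ℓ} (P? : Decidable P) (Q? : Decidable Q) where

  #-mono : (∀ i → P i → Q i) → # P? ≤ # Q?
  #-mono f = subst₂ _≤_ (trans (cong (# P? +_) (#-none {n})) (+-identityʳ _))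
                        (trans (cong (# Q? +_) (#-none {n})) (+-identityʳ _))
    (#-sum P? ∅? Q? ∅? (λ i → Sum.map₁ (f i)) (λ _ → ⊥-elim ∘ proj₂))

  #-∪ : # (P? ∪? Q?) ≤ # P? + # Q?
  #-∪ = subst (_≤ # P? + # Q?) (trans (cong (# (P? ∪? Q?) +_) (#-none {n})) (+-identityʳ _))
    (#-sum (P? ∪? Q?) ∅? P? Q? (λ _ → [ id , (λ ()) ]′) (λ _ → ⊥-elim ∘ proj₂))

  #-∪-≤ : ∀ {p q} → # P? ≤ p → # Q? ≤ q → # (P? ∪? Q?) ≤ p + q
  #-∪-≤ a b = ≤-trans #-∪ (a ⊕ b)

  #-∩∪ : # (P? ∩? Q?) + # (P? ∪? Q?) ≤ # P? + # Q?
  #-∩∪ = #-sum (P? ∩? Q?) (P? ∪? Q?) P? Q? (λ _ → [ inj₁ ∘ proj₁ , id ]′) (λ _ → proj₁)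

module _ {n : ℕ} {P : Pred (Fin n) 0ℓ} (P? : Decidable P) where

  #-full : (∀ i → P i) → n ≤ # P?
  #-full f = subst (_≤ # P?) (#-all {n}) (#-mono U? P? (λ i _ → f i))

  #-∁-≥ : n ≤ # P? + # (∁? P?)
  #-∁-≥ = subst (_≤ # P? + # (∁? P?)) (trans (cong₂ _+_ (#-all {n}) (#-none {n})) (+-identityʳ n))
    (#-sum U? ∅? P? (∁? P?) (λ i _ → toSum (P? i)) (λ _ → ⊥-elim ∘ proj₂))

  #-∁-≤ : # P? + # (∁? P?) ≤ n
  #-∁-≤ = subst (# P? + # (∁? P?) ≤_) (trans (cong₂ _+_ (#-all {n}) (#-none {n})) (+-identityʳ n))
    (#-sum P? (∁? P?) U? ∅? (λ i _ → inj₁ tt) (λ { _ (p , ¬p) → tt , ¬p p }))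

#-remove : ∀ {n} {Q : Pred (Fin n) 0ℓ} (Q? : Decidable Q) x → Q x →
  suc (# (Q? ∩? ∁? (Fin._≟ x))) ≤ # Q?
#-remove Q? zero q with Q? zero
... | yes _ = s≤s (#-mono ((Q? ∩? ∁? (Fin._≟ zero)) ∘ suc) (Q? ∘ suc) (λ _ → proj₁))
... | no ¬q = contradiction q ¬q
#-remove Q? (suc x) q = begin
  suc (𝟙 (Q₀? zero) + # (Q₀? ∘ suc))
    ≡⟨ +-suc (𝟙 (Q₀? zero)) _ ⟨
  𝟙 (Q₀? zero) + suc (# (Q₀? ∘ suc))
    ≤⟨ +-mono-≤ here-≤ (s≤s (#-mono (Q₀? ∘ suc) ((Q? ∘ suc) ∩? ∁? (Fin._≟ x))
         (λ i → map₂ (_∘ cong suc)))) ⟩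
  𝟙 (Q? zero) + suc (# ((Q? ∘ suc) ∩? ∁? (Fin._≟ x)))
    ≤⟨ +-monoʳ-≤ _ (#-remove (Q? ∘ suc) x q) ⟩
  # Q? ∎
  where
  open ≤-Reasoning
  Q₀? = Q? ∩? ∁? (Fin._≟ suc x)
  here-≤ : 𝟙 (Q₀? zero) ≤ 𝟙 (Q? zero)
  here-≤ with Q? zero
  ... | yes _ = ≤-refl
  ... | no _ = z≤n

#-inj : ∀ {m n} {P : Pred (Fin m) 0ℓ} {Q : Pred (Fin n) 0ℓ}
  (P? : Decidable P) (Q? : Decidable Q) (f : Fin m → Fin n) → Injective _≡_ _≡_ f →
  (∀ i → P i → Q (f i)) → # P? ≤ # Q?
#-inj {zero} _ _ _ _ _ = z≤n
#-inj {suc m} P? Q? f f-inj P⇒Q with P? zero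
... | no _ = #-inj (P? ∘ suc) Q? (f ∘ suc) (Fin.suc-injective ∘ f-inj) (P⇒Q ∘ suc)
-- The image of `zero` is deleted from the target; injectivity keeps the other images away from it.
... | yes p = ≤-trans
  (s≤s (#-inj (P? ∘ suc) (Q? ∩? ∁? (Fin._≟ f zero)) (f ∘ suc) (Fin.suc-injective ∘ f-inj)
    (λ i pi → P⇒Q (suc i) pi , λ eq → case f-inj eq of λ ())))
  (#-remove Q? (f zero) (P⇒Q zero p))

#-singleton : ∀ {n} (x : Fin n) → # (Fin._≟ x) ≤ 1
#-singleton {suc n} zero = s≤s (≤-trans (#-mono {n} (λ i → suc i Fin.≟ zero) ∅? (λ _ ())) (≤-reflexive (#-none {n})))
#-singleton (suc x) = ≤-trans (#-mono (λ i → suc i Fin.≟ suc x) (Fin._≟ x) (λ _ → Fin.suc-injective)) (#-singleton x)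

enumerate : ∀ {n} {P : Pred (Fin n) 0ℓ} (P? : Decidable P) k → k ≤ # P? →
  Σ (Fin k → Fin n) λ e → Injective _≡_ _≡_ e × (∀ i → P (e i))
enumerate P? zero _ = (λ ()) , (λ {}) , λ ()
enumerate {suc n} P? (suc k) k≤ with P? zero
... | no _ with e , e-inj , e-P ← enumerate (P? ∘ suc) (suc k) k≤ =
  suc ∘ e , e-inj ∘ Fin.suc-injective , e-P
... | yes p with e , e-inj , e-P ← enumerate (P? ∘ suc) k (≤-pred k≤) = e′ , inj , e′-P
  where
  e′ : Fin (suc k) → Fin (suc n)
  e′ zero    = zero
  e′ (suc i) = suc (e i)
  inj : Injective _≡_ _≡_ e′
  inj {zero}  {zero}  _  = refl
  inj {suc _} {suc _} eq = cong suc (e-inj (Fin.suc-injective eq))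
  e′-P : ∀ i → _
  e′-P zero    = p
  e′-P (suc i) = e-P i

inhabited : ∀ {n} {P : Pred (Fin n) 0ℓ} (P? : Decidable P) → 1 ≤ # P? → ∃ P
inhabited P? 1≤ with e , _ , e-P ← enumerate P? 1 1≤ = e zero , e-P zero

-- König's theorem

BiGraph : ℕ → ℕ → Set₁
BiGraph m n = Fin m → Fin n → Set

record Matching {m n} (E : BiGraph m n) (t : ℕ) : Set where
  field
    source     : Fin t → Fin m
    target     : Fin t → Fin n
    source-inj : Injective _≡_ _≡_ source
    target-inj : Injective _≡_ _≡_ target
    edge       : ∀ i → E (source i) (target i)

record VertexCover {m n} (E : BiGraph m n) (t : ℕ) : Set₁ where
  field
    {Left}  : Pred (Fin m) 0ℓ
    {Right} : Pred (Fin n) 0ℓ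
    left?   : Decidable Left
    right?  : Decidable Right
    covers  : ∀ i j → E i j → Left i ⊎ Right j
    size    : # left? + # right? ≤ t

open Matching
open VertexCover

-- Matching edges are disjoint, so each cover vertex is charged at most once. The subset `S` allows
-- counting only the edges outside one component.
weak-duality : ∀ {t m n} {S : Pred (Fin t) 0ℓ} {P : Pred (Fin m) 0ℓ} {Q : Pred (Fin n) 0ℓ}
  (S? : Decidable S) (P? : Decidable P) (Q? : Decidable Q) {E : BiGraph m n} (M : Matching E t) →
  (∀ i → S i → P (source M i) ⊎ Q (target M i)) → # S? ≤ # P? + # Q?
weak-duality S? P? Q? M f = ≤-trans
  (#-mono S? ((P? ∘ source M) ∪? (Q? ∘ target M)) f)
  (#-∪-≤ (P? ∘ source M) (Q? ∘ target M) (#-inj (P? ∘ source M) P? (source M) (source-inj M) (λ _ → id))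
             (#-inj (Q? ∘ target M) Q? (target M) (target-inj M) (λ _ → id)))

-- Minimum covers are closed under intersecting the left parts and uniting the right
-- parts, because the dual combination is again a cover.
meet : ∀ {m n t} {E : BiGraph m n} → Matching E t → VertexCover E t → VertexCover E t → VertexCover E t
meet {t = t} {E} M K K′ = record
  { left?  = left? K ∩? left? K′
  ; right? = right? K ∪? right? K′
  ; covers = λ i j e → meets (covers K i j e) (covers K′ i j e)
  ; size   = +-cancelʳ-≤ t _ _ (≤-trans
      (+-monoʳ-≤ (# (left? K ∩? left? K′) + # (right? K ∪? right? K′)) dual)
      (regroup {# (left? K ∩? left? K′)} {# (left? K ∪? left? K′)}
               {# (right? K ∩? right? K′)} {# (right? K ∪? right? K′)}
        (# (left? K)) (# (left? K′)) (# (right? K)) (# (right? K′))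
        (#-∩∪ (left? K) (left? K′)) (#-∩∪ (right? K) (right? K′)) (size K) (size K′)))
  }
  where
  meets : ∀ {A A′ B B′ : Set} → A ⊎ B → A′ ⊎ B′ → (A × A′) ⊎ (B ⊎ B′)
  meets (inj₁ a) (inj₁ a′) = inj₁ (a , a′)
  meets (inj₂ b) _         = inj₂ (inj₁ b)
  meets (inj₁ _) (inj₂ b′) = inj₂ (inj₂ b′)
  joins : ∀ {A A′ B B′ : Set} → A ⊎ B → A′ ⊎ B′ → (A ⊎ A′) ⊎ (B × B′)
  joins (inj₁ a) _         = inj₁ (inj₁ a)
  joins (inj₂ _) (inj₁ a′) = inj₁ (inj₂ a′)
  joins (inj₂ b) (inj₂ b′) = inj₂ (b , b′)
  dual : t ≤ # (left? K ∪? left? K′) + # (right? K ∩? right? K′)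
  dual = ≤-trans (#-full {t} U? (λ _ → tt))
    (weak-duality U? (left? K ∪? left? K′) (right? K ∩? right? K′) M (λ i _ → joins (covers K _ _ (edge M i)) (covers K′ _ _ (edge M i))))
  regroup : ∀ {a b c d} x x′ y y′ → a + b ≤ x + x′ → c + d ≤ y + y′ → x + y ≤ t → x′ + y′ ≤ t →
    a + d + (b + c) ≤ t + t
  regroup {a} {b} {c} {d} x x′ y y′ h₁ h₂ h₃ h₄ = begin
    a + d + (b + c)     ≡⟨ solve (a ∷ b ∷ c ∷ d ∷ []) ⟩
    a + b + (c + d)     ≤⟨ h₁ ⊕ h₂ ⟩
    x + x′ + (y + y′)   ≡⟨ solve (x ∷ x′ ∷ y ∷ y′ ∷ []) ⟩
    x + y + (x′ + y′)   ≤⟨ h₃ ⊕ h₄ ⟩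
    t + t               ∎
    where open ≤-Reasoning

module _ {m n} {E : BiGraph (suc m) n} (E? : ∀ i → Decidable (E i)) where

  private
    E′ : BiGraph m n
    E′ i = E (suc i)

    E∖ : Fin n → BiGraph m n
    E∖ b i j = E′ i j × j ≢ b

  extend-matching : ∀ {t b} → E zero b → Matching (E∖ b) t → Matching E (suc t)
  extend-matching {t} {b} e M = record
    { source = f ; target = g ; source-inj = f-inj ; target-inj = g-inj ; edge = fg }
    where
    f : Fin (suc t) → Fin (suc m)
    f zero    = zero
    f (suc i) = suc (source M i)
    g : Fin (suc t) → Fin n
    g zero    = b
    g (suc i) = target M i
    f-inj : Injective _≡_ _≡_ f
    f-inj {zero}  {zero}  _  = refl
    f-inj {suc _} {suc _} eq = cong suc (source-inj M (Fin.suc-injective eq))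
    g-inj : Injective _≡_ _≡_ g
    g-inj {zero}  {zero}  _  = refl
    g-inj {zero}  {suc j} eq = contradiction (sym eq) (proj₂ (edge M j))
    g-inj {suc i} {zero}  eq = contradiction eq (proj₂ (edge M i))
    g-inj {suc _} {suc _} eq = cong suc (target-inj M eq)
    fg : ∀ i → E (f i) (g i)
    fg zero    = e
    fg (suc i) = proj₁ (edge M i)

  lift-matching : ∀ {t} → Matching E′ t → Matching E t
  lift-matching M = record
    { source = suc ∘ source M ; target = target M
    ; source-inj = source-inj M ∘ Fin.suc-injective ; target-inj = target-inj M ; edge = edge M }

  -- The vertex `b` pays for all edges at `b`. The new cover contains `b`, which is what `gather`
  -- asks for.
  restore : ∀ {t b} → VertexCover (E∖ b) t → VertexCover E′ (suc t)
  restore {t} {b} K = record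
    { left? = left? K ; right? = (Fin._≟ b) ∪? right? K
    ; covers = cov
    ; size = ≤-trans (+-monoʳ-≤ (# (left? K)) (#-∪-≤ (Fin._≟ b) (right? K) (#-singleton b) ≤-refl))
        (≤-trans (≤-reflexive (+-suc (# (left? K)) _)) (s≤s (size K)))
    }
    where
    cov : ∀ i j → E′ i j → Left K i ⊎ (j ≡ b ⊎ Right K j)
    cov i j e with j Fin.≟ b
    ... | yes j≡b = inj₂ (inj₁ j≡b)
    ... | no j≢b  = Sum.map₂ inj₂ (covers K i j (e , j≢b))

  cover-with-zero : ∀ {t} → VertexCover E′ t → VertexCover E (suc t)
  cover-with-zero K = record
    { Left = λ { zero → ⊤ ; (suc i) → Left K i }
    ; left? = λ { zero → yes tt ; (suc i) → left? K i }
    ; right? = right? K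
    ; covers = λ { zero _ _ → inj₁ tt ; (suc i) → covers K i }
    ; size = s≤s (size K) }

  cover-without-zero : ∀ {t} (K : VertexCover E′ t) → (∀ j → E zero j → Right K j) → VertexCover E t
  cover-without-zero K nbrs = record
    { Left = λ { zero → ⊥ ; (suc i) → Left K i }
    ; left? = λ { zero → no id ; (suc i) → left? K i }
    ; right? = right? K
    ; covers = λ { zero j e → inj₂ (nbrs j e) ; (suc i) → covers K i }
    ; size = size K }

  -- `meet` unites right parts, so a neighbour once included stays included, while the matching
  -- keeps the size at `t`.
  gather : ∀ {t} → Matching E′ t → VertexCover E′ t →
    (∀ j → E zero j → Σ (VertexCover E′ t) λ K → Right K j) →
    (js : List (Fin n)) → Σ (VertexCover E′ t) λ K → ∀ j → j ∈ js → E zero j → Right K j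
  gather M K₀ h [] = K₀ , λ _ ()
  gather M K₀ h (j ∷ js) with E? zero j | gather M K₀ h js
  ... | no ¬e | K , has = K , λ { _ (here refl) e → contradiction e ¬e ; k (there k∈) → has k k∈ }
  ... | yes e | K , has with K′ , has′ ← h j e =
    meet M K′ K , λ { _ (here refl) _ → inj₁ has′ ; k (there k∈) e → inj₂ (has k k∈ e) }

relax : ∀ {m n s t} {E : BiGraph m n} → s ≤ t → VertexCover E s → VertexCover E t
relax s≤t K = record { VertexCover K ; size = ≤-trans (size K) s≤t }

-- Delete the left vertex 0. If deleting also some neighbour b of 0 does not lower the
-- matching number, then 0b extends a matching; otherwise every neighbour of 0 lies in
-- some minimum cover of the rest, hence all of them lie in a common one.
könig : ∀ m {n} {E : BiGraph m n} → (∀ i → Decidable (E i)) →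
  ∃ λ t → Matching E t × VertexCover E t
könig zero {n} E? = 0
  , record { source = λ () ; target = λ () ; source-inj = λ {} ; target-inj = λ {} ; edge = λ () }
  , record { left? = U? ; right? = ∅? ; covers = λ () ; size = ≤-reflexive (#-none {n}) }
könig (suc m) {n} {E} E?
  with t , M , K ← könig m (E? ∘ suc)
  with deleted ← (λ b → könig m {E = λ i j → E (suc i) j × j ≢ b} (λ i j → E? (suc i) j ×-dec ¬? (j Fin.≟ b)))
  with Fin.any? (λ b → E? zero b ×-dec (t ≤? proj₁ (deleted b)))
... | yes (b , e , t≤) = suc (proj₁ (deleted b))
  , extend-matching E? e (proj₁ (proj₂ (deleted b)))
  , cover-with-zero E? (relax t≤ K)
... | no small with K′ , nbrs ← gather E? M K
      (λ b e → relax (≰⇒> (λ t≤ → small (b , e , t≤))) (restore E? (proj₂ (proj₂ (deleted b)))) , inj₁ refl)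
      (allFin n) =
  t , lift-matching E? M , cover-without-zero E? K′ (λ j → nbrs j (∈-allFin j))

-- Components of one colour, and covers bounded on each component.

_≟ᶜ_ : DecidableEquality Colour
red   ≟ᶜ red   = yes refl
red   ≟ᶜ blue  = no λ ()
red   ≟ᶜ green = no λ ()
blue  ≟ᶜ red   = no λ ()
blue  ≟ᶜ blue  = yes refl
blue  ≟ᶜ green = no λ ()
green ≟ᶜ red   = no λ ()
green ≟ᶜ blue  = no λ ()
green ≟ᶜ green = yes refl

_≟ᵛ_ : ∀ {n} → DecidableEquality (Vertex n)
_≟ᵛ_ = Sum.≡-dec Fin._≟_ Fin._≟_

Coloured : ∀ {n} → Colouring n → Colour → BiGraph n n
Coloured col c i j = col i j ≡ c

module _ {n : ℕ} (col : Colouring n) (c : Colour) where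

  -- The two laws make the fibres of `label` exactly the components, so that membership becomes a
  -- decidable equality.
  record ComponentLabels : Set where
    field
      label     : Vertex n → Vertex n
      connected : ∀ x y → label x ≡ label y → Connected col c x y
      joined    : ∀ i j → col i j ≡ c → label (inj₁ i) ≡ label (inj₂ j)

  Adj-sym : Symmetric (Adj col c)
  Adj-sym (lr e) = rl e
  Adj-sym (rl e) = lr e

  private
    merge : ∀ (ℓ : Vertex n → Vertex n) u v → Vertex n → Vertex n
    merge ℓ u v w = if does (w ≟ᵛ ℓ u) then ℓ v else w

    Sound : (Vertex n → Vertex n) → Set
    Sound ℓ = ∀ x y → ℓ x ≡ ℓ y → Connected col c x y

    merge-joins : ∀ ℓ u v → merge ℓ u v (ℓ u) ≡ merge ℓ u v (ℓ v)
    merge-joins ℓ u v with ℓ u ≟ᵛ ℓ u | ℓ v ≟ᵛ ℓ u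
    ... | yes _ | yes _ = refl
    ... | yes _ | no _  = refl
    ... | no ≢  | _     = contradiction refl ≢

    merge-sound : ∀ ℓ u v → Sound ℓ → Adj col c u v → Sound (merge ℓ u v ∘ ℓ)
    merge-sound ℓ u v sound e x y eq with ℓ x ≟ᵛ ℓ u | ℓ y ≟ᵛ ℓ u
    ... | yes p | yes q = sound x y (trans p (sym q))
    ... | yes p | no _  = sound x u p ◅◅ e ◅ sound v y eq
    ... | no _  | yes q = sound x v eq ◅◅ Adj-sym e ◅ sound u y (sym q)
    ... | no _  | no _  = sound x y eq

    -- Union-find: each edge of colour `c` fuses the labels of its ends. Merging composes with a map
    -- on labels, so earlier equalities survive.
    process : (es : List (Fin n × Fin n)) → Σ (Vertex n → Vertex n) λ ℓ → Sound ℓ ×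
      (∀ {i j} → (i , j) ∈ es → col i j ≡ c → ℓ (inj₁ i) ≡ ℓ (inj₂ j))
    process [] = id , (λ { _ _ refl → ε }) , λ ()
    process ((i , j) ∷ es) with col i j ≟ᶜ c | process es
    ... | no ≢  | ℓ , sound , old = ℓ , sound , λ
      { (here refl) e → contradiction e ≢ ; (there ∈es) → old ∈es }
    ... | yes e | ℓ , sound , old =
      merge ℓ (inj₁ i) (inj₂ j) ∘ ℓ , merge-sound ℓ _ _ sound (lr e) , λ
      { (here refl) _ → merge-joins ℓ (inj₁ i) (inj₂ j)
      ; (there ∈es) e′ → cong (merge ℓ (inj₁ i) (inj₂ j)) (old ∈es e′) }

  componentLabels : ComponentLabels
  componentLabels with ℓ , sound , all ← process (cartesianProduct (allFin n) (allFin n)) = record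
    { label = ℓ ; connected = sound
    ; joined = λ i j → all (∈-cartesianProduct⁺ (∈-allFin i) (∈-allFin j)) }

  open ComponentLabels

  module _ (Λ : ComponentLabels) where

    In : ∀ {A : Set} → (A → Vertex n) → Vertex n → Pred A 0ℓ
    In v x a = label Λ (v a) ≡ x

    in? : ∀ {A : Set} (v : A → Vertex n) x → Decidable (In v x)
    in? v x a = label Λ (v a) ≟ᵛ x

    -- `total` ensures that at least `n` of the `2n` vertices stay uncovered.
    record BoundedCover (κ : ℕ) : Set₁ where
      field
        {Left Right} : Pred (Fin n) 0ℓ
        left?   : Decidable Left
        right?  : Decidable Right
        covers  : ∀ i j → col i j ≡ c → Left i ⊎ Right j
        bounded : ∀ x → # (left? ∩? in? inj₁ x) + # (right? ∩? in? inj₂ x) ≤ κ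
        total   : # left? + # right? ≤ n

    module _ {t} (M : Matching (Coloured col c) t) where

      edge-in? : ∀ x → Decidable (In (inj₁ ∘ source M) x)
      edge-in? = in? (inj₁ ∘ source M)

      source-in : ∀ i {x} → In inj₂ x (target M i) → In inj₁ x (source M i)
      source-in i = trans (joined Λ _ _ (edge M i))

      conn-matching : ∀ {k} x → k ≤ # (edge-in? x) → HasConnMatching col c k
      conn-matching x k≤ with e , e-inj , e-in ← enumerate (edge-in? x) _ k≤ =
        source M ∘ e , target M ∘ e , e-inj ∘ source-inj M , e-inj ∘ target-inj M , edge M ∘ e ,
        λ i j → connected Λ _ _ (trans (e-in i) (sym (e-in j)))

      matched≤ : t ≤ n
      matched≤ = Fin.injective⇒≤ (source-inj M)

      module _ {κ} (bounded : ∀ x → # (edge-in? x) ≤ κ) where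

        -- The matching edges outside component x need as many cover vertices there.
        boundedCover : VertexCover (Coloured col c) t → BoundedCover κ
        boundedCover K = record
          { left? = left? K ; right? = right? K ; covers = covers K
          ; bounded = λ x → ≤-trans (local x) (bounded x)
          ; total = ≤-trans (size K) matched≤ }
          where
          local : ∀ x → # (left? K ∩? in? inj₁ x) + # (right? K ∩? in? inj₂ x) ≤ # (edge-in? x)
          local x = subtract {a = # (left? K ∩? in? inj₁ x)} {b = # (right? K ∩? in? inj₂ x)}
            (split (left? K) (in? inj₁ x)) (split (right? K) (in? inj₂ x)) (size K)
            (#-full (edge-in? x ∪? ∁? (edge-in? x)) λ i → toSum (edge-in? x i))
            (#-∪ (edge-in? x) (∁? (edge-in? x)))
            (weak-duality (∁? (edge-in? x)) (left? K ∩? ∁? (in? inj₁ x)) (right? K ∩? ∁? (in? inj₂ x)) M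
              λ i out → Sum.map (_, out) (_, out ∘ source-in i) (covers K _ _ (edge M i)))
            where
            split : ∀ {m} {P Q : Pred (Fin m) 0ℓ} (P? : Decidable P) (Q? : Decidable Q) →
              # (P? ∩? Q?) + # (P? ∩? ∁? Q?) ≤ # P?
            split {m} P? Q? = ≤-trans
              (#-sum (P? ∩? Q?) (P? ∩? ∁? Q?) P? ∅? (λ _ → [ inj₁ ∘ proj₁ , inj₁ ∘ proj₁ ]′)
                (λ { _ ((_ , q) , (_ , ¬q)) → contradiction q ¬q }))
              (≤-reflexive (trans (cong (# P? +_) (#-none {m})) (+-identityʳ _)))
            subtract : ∀ {a a′ l b b′ r e e′ u} → a + a′ ≤ l → b + b′ ≤ r → l + r ≤ t →
              t ≤ u → u ≤ e + e′ → e′ ≤ a′ + b′ → a + b ≤ e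
            subtract {a} {a′} {l} {b} {b′} {r} {e} {e′} {u} h₁ h₂ h₃ h₄ h₅ h₆ =
              +-cancelʳ-≤ (a′ + b′ + (l + r) + t + u + e′) _ _ (begin
                a + b + (a′ + b′ + (l + r) + t + u + e′)
                  ≡⟨ solve (a ∷ a′ ∷ l ∷ b ∷ b′ ∷ r ∷ e′ ∷ u ∷ t ∷ []) ⟩
                a + a′ + (b + b′ + (l + r + (t + (u + e′))))
                  ≤⟨ h₁ ⊕ h₂ ⊕ h₃ ⊕ h₄ ⊕ h₅ ⊕ h₆ ⟩
                l + (r + (t + (u + (e + e′ + (a′ + b′)))))
                  ≡⟨ solve (a′ ∷ l ∷ b′ ∷ r ∷ e ∷ e′ ∷ u ∷ t ∷ []) ⟩
                e + (a′ + b′ + (l + r) + t + u + e′) ∎)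
              where open ≤-Reasoning

        -- Substitute for a cover that exhausts one side: this one leaves vertices uncovered
        -- on both sides.
        swappedCover : n ≤ t → Vertex n → VertexCover (Coloured col c) t
        swappedCover n≤t x = record
          { left? = ∁? (in? inj₁ x) ; right? = in? inj₂ x
          ; covers = cov
          ; size = subtract {a = # (in? inj₁ x)} {b = # (in? inj₂ x)} {e = # (edge-in? x)}
              (#-∁-≤ (in? inj₁ x)) (#-∁-≤ (in? inj₂ x)) n≤t (#-∁-≥ (edge-in? x))
              (#-inj (edge-in? x) (in? inj₁ x) (source M) (source-inj M) (λ _ → id))
              (#-inj (∁? (edge-in? x)) (∁? (in? inj₂ x)) (target M) (target-inj M) (λ i out → out ∘ source-in i))
          }
          where
          cov : ∀ i j → col i j ≡ c → ¬ In inj₁ x i ⊎ In inj₂ x j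
          cov i j e with in? inj₁ x i
          ... | yes p = inj₂ (trans (sym (joined Λ i j e)) p)
          ... | no ¬p = inj₁ ¬p
          subtract : ∀ {a a′ b b′ e e′} → a + a′ ≤ n → b + b′ ≤ n → n ≤ t → t ≤ e + e′ → e ≤ a → e′ ≤ b′ →
            a′ + b ≤ t
          subtract {a} {a′} {b} {b′} {e} {e′} h₁ h₂ h₃ h₄ h₅ h₆ =
            ≤-trans (+-cancelʳ-≤ (a + b′ + n + t + e + e′) _ _ (begin
                a′ + b + (a + b′ + n + t + e + e′)
                  ≡⟨ solve (a ∷ a′ ∷ b ∷ b′ ∷ e ∷ e′ ∷ n ∷ t ∷ []) ⟩
                a + a′ + (b + b′ + (n + (t + (e + e′))))
                  ≤⟨ h₁ ⊕ h₂ ⊕ h₃ ⊕ h₄ ⊕ h₅ ⊕ h₆ ⟩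
                n + (n + (t + (e + e′ + (a + b′))))
                  ≡⟨ solve (a ∷ b′ ∷ e ∷ e′ ∷ n ∷ t ∷ []) ⟩
                n + (a + b′ + n + t + e + e′) ∎)) h₃
            where open ≤-Reasoning

    -- If no component holds `κ + 1` edges of a maximum matching, König's cover is bounded. Should
    -- it fill a whole side, the matching is perfect and `swappedCover` replaces it. The uncovered
    -- vertices later supply a free vertex on each side.
    conn-matching-or-cover : ∀ κ → suc κ ≤ n → HasConnMatching col c (suc κ) ⊎
      Σ (BoundedCover κ) λ K → ∃ (∁ (BoundedCover.Left K)) × ∃ (∁ (BoundedCover.Right K))
    conn-matching-or-cover κ κ<n with t , M , K ← könig n {E = Coloured col c} (λ i j → col i j ≟ᶜ c)
      with Fin.any? (λ i → suc κ ≤? # (edge-in? M (label Λ (inj₁ (source M i)))))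
    ... | yes (i , big) = inj₁ (conn-matching M _ big)
    ... | no ¬big = inj₂ balanced
      where
      small : ∀ x → # (edge-in? M x) ≤ κ
      small x with suc κ ≤? # (edge-in? M x)
      ... | no ≰ = ≤-pred (≰⇒> ≰)
      ... | yes big with i , refl ← inhabited (edge-in? M x) (≤-trans (s≤s z≤n) big) =
        contradiction (i , big) ¬big
      all-in : ∀ {P : Pred (Fin n) 0ℓ} (P? : Decidable P) → ¬ ∃ (∁ P) → n ≤ # P?
      all-in P? none = #-full P? λ i → decidable-stable (P? i) (λ ¬p → none (i , ¬p))
      swapped : n ≤ t → Σ (BoundedCover κ) λ K → ∃ (∁ (BoundedCover.Left K)) × ∃ (∁ (BoundedCover.Right K))
      swapped n≤t = K′ , (i₀ , (λ ≢ → ≢ refl)) , outside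
        where
        i₀ : Fin n
        i₀ = proj₁ (inhabited {n} U? (≤-trans (s≤s z≤n) (≤-trans κ<n (#-full {n} U? (λ _ → tt)))))
        x = label Λ (inj₁ i₀)
        K′ = boundedCover M small (swappedCover M small n≤t x)
        outside : ∃ (∁ (In inj₂ x))
        outside with Fin.any? (∁? (in? inj₂ x))
        ... | yes found = found
        -- If all right vertices lay in component `x`, that component would contain `n > κ` cover
        -- vertices.
        ... | no none = contradiction
          (≤-trans (≤-trans (all-in (in? inj₂ x) none)
                            (#-mono (in? inj₂ x) (in? inj₂ x ∩? in? inj₂ x) (λ _ p → p , p)))
                   (m+n≤o⇒n≤o _ (BoundedCover.bounded K′ x)))
          (<⇒≱ κ<n)
      balanced : Σ (BoundedCover κ) λ K → ∃ (∁ (BoundedCover.Left K)) × ∃ (∁ (BoundedCover.Right K))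
      balanced with Fin.any? (∁? (left? K)) | Fin.any? (∁? (right? K))
      ... | yes l | yes r = boundedCover M small K , l , r
      ... | no none | _ = swapped (≤-trans (all-in (left? K) none) (m+n≤o⇒m≤o _ (size K)))
      ... | _ | no none = swapped (≤-trans (all-in (right? K) none) (m+n≤o⇒n≤o _ (size K)))

-- Configurations: labels and covers abstracted from a colouring.

data Side : Set where
  left right : Side

opposite : Side → Side
opposite left  = right
opposite right = left

swapRB : Colour → Colour
swapRB red   = blue
swapRB blue  = red
swapRB green = green

module Covers {L : Set} (_≟_ : DecidableEquality L) {n : ℕ} where

  -- A labelling of components together with a choice of covers, one per colour; these
  -- data retain all that the argument needs from a colouring of K_{n,n}.
  record Config (γ δ : ℕ) : Set₁ where
    field
      label    : Side → Colour → Fin n → L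
      Covered  : Side → Colour → Pred (Fin n) 0ℓ
      covered? : ∀ s c → Decidable (Covered s c)

    Owned : Side → Colour → L → Pred (Fin n) 0ℓ
    Owned s c x i = Covered s c i × label s c i ≡ x

    owned? : ∀ s c x → Decidable (Owned s c x)
    owned? s c x i = covered? s c i ×-dec (label s c i ≟ x)

    Free : Side → Pred (Fin n) 0ℓ
    Free s i = ¬ Covered s green i

    free? : ∀ s → Decidable (Free s)
    free? s i = ¬? (covered? s green i)

    -- What is kept of an edge of colour `c`. It may hold for several colours at once.
    Meets : Colour → Fin n → Fin n → Set
    Meets c i j = label left c i ≡ label right c j × (Covered left c i ⊎ Covered right c j)

    owned : Side → Colour → L → ℕ
    owned s c x = # (owned? s c x)

    field
      spanned   : ∀ i j → Meets red i j ⊎ Meets blue i j ⊎ Meets green i j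
      cap-red   : ∀ x → owned left red x + owned right red x ≤ γ
      cap-blue  : ∀ x → owned left blue x + owned right blue x ≤ δ
      cap-green : ∀ x → owned left green x + owned right green x ≤ γ + δ
      large     : suc (γ + δ + (γ + δ)) ≤ n
      free-size : n ≤ # (free? left) + # (free? right)

    cap : Colour → ℕ
    cap red   = γ
    cap blue  = δ
    cap green = γ + δ

    owned≤ : ∀ s c x → owned s c x ≤ cap c
    owned≤ left  red   x = m+n≤o⇒m≤o _ (cap-red x)
    owned≤ right red   x = m+n≤o⇒n≤o _ (cap-red x)
    owned≤ left  blue  x = m+n≤o⇒m≤o _ (cap-blue x)
    owned≤ right blue  x = m+n≤o⇒n≤o _ (cap-blue x)
    owned≤ left  green x = m+n≤o⇒m≤o _ (cap-green x)
    owned≤ right green x = m+n≤o⇒n≤o _ (cap-green x)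

  -- This symmetry and `swapColours`, which also exchanges `γ` and `δ`, let later claims be proved
  -- for one side and one colour.
  swapSides : ∀ {γ δ} → Config γ δ → Config γ δ
  swapSides C = record
    { label = label ∘ opposite ; Covered = Covered ∘ opposite ; covered? = covered? ∘ opposite
    ; spanned = λ i j → Sum.map flip (Sum.map flip flip) (spanned j i)
    ; cap-red = λ x → ≤-trans (≤-reflexive (+-comm (owned right red x) _)) (cap-red x)
    ; cap-blue = λ x → ≤-trans (≤-reflexive (+-comm (owned right blue x) _)) (cap-blue x)
    ; cap-green = λ x → ≤-trans (≤-reflexive (+-comm (owned right green x) _)) (cap-green x)
    ; large = large
    ; free-size = ≤-trans free-size (≤-reflexive (+-comm (# (free? left)) _)) }
    where
    open Config C
    flip : ∀ {x y : L} {A B : Set} → x ≡ y × (A ⊎ B) → y ≡ x × (B ⊎ A)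
    flip (e , o) = sym e , Sum.swap o

  swapColours : ∀ {γ δ} → Config γ δ → Config δ γ
  swapColours {γ} {δ} C = record
    { label = λ s → label s ∘ swapRB ; Covered = λ s → Covered s ∘ swapRB ; covered? = λ s → covered? s ∘ swapRB
    ; spanned = λ i j → [ inj₂ ∘ inj₁ , [ inj₁ , inj₂ ∘ inj₂ ]′ ]′ (spanned i j)
    ; cap-red = cap-blue
    ; cap-blue = cap-red
    ; cap-green = λ x → ≤-trans (cap-green x) (≤-reflexive (+-comm γ δ))
    ; large = subst (λ s → suc (s + s) ≤ n) (+-comm γ δ) large
    ; free-size = free-size }
    where open Config C

  module _ {γ δ : ℕ} (C : Config γ δ) where
    open Config C

    overfull : ∀ {x} → n ≤ x → x ≤ γ + δ + (γ + δ) → ⊥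
    overfull n≤x x≤ = <⇒≱ large (≤-trans n≤x x≤)

    -- The standard contradiction: sets containing all free vertices are listed, their sizes sum to
    -- at most `γ + δ + (γ + δ)`, and `overfull` applies.
    free-cover : ∀ {P Q : Pred (Fin n) 0ℓ} (P? : Decidable P) (Q? : Decidable Q) →
      (∀ i → Free left i → P i) → (∀ j → Free right j → Q j) → n ≤ # P? + # Q?
    free-cover P? Q? f g = ≤-trans free-size (#-mono (free? left) P? f ⊕ #-mono (free? right) Q? g)

    -- Otherwise all edges at i are covered from the right, by at most γ + δ + (γ + δ) vertices.
    free-left-covered : ∀ i → Free left i → Covered left red i ⊎ Covered left blue i
    free-left-covered i ¬g with covered? left red i | covered? left blue i
    ... | yes r | _     = inj₁ r
    ... | no _  | yes b = inj₂ b
    ... | no ¬r | no ¬b = ⊥-elim (overfull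
      (≤-trans (#-full (owned? right red (ℓ red) ∪? owned? right blue (ℓ blue) ∪? owned? right green (ℓ green)) all)
        (#-∪-≤ (owned? right red _) (owned? right blue _ ∪? owned? right green _) (owned≤ right red _)
          (#-∪-≤ (owned? right blue _) (owned? right green _) (owned≤ right blue _) (owned≤ right green _))))
      (≤-reflexive (sym (+-assoc γ δ _))))
      where
      ℓ : Colour → L
      ℓ c = label left c i
      from-right : ∀ {c j} → ¬ Covered left c i → Meets c i j → Owned right c (ℓ c) j
      from-right ¬l (_ , inj₁ l) = contradiction l ¬l
      from-right _  (e , inj₂ r) = r , sym e
      all : ∀ j → Owned right red (ℓ red) j ⊎ Owned right blue (ℓ blue) j ⊎ Owned right green (ℓ green) j
      all j = Sum.map (from-right ¬r) (Sum.map (from-right ¬b) (from-right ¬g)) (spanned i j)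

  free-right-covered : ∀ {γ δ} (C : Config γ δ) → let open Config C in
    ∀ j → Free right j → Covered right red j ⊎ Covered right blue j
  free-right-covered C = free-left-covered (swapSides C)

  module _ {γ δ : ℕ} (C : Config γ δ) where
    open Config C

    free-edge : ∀ {i j} → Free left i → Free right j → Meets red i j ⊎ Meets blue i j
    free-edge {i} {j} fi fj with spanned i j
    ... | inj₁ m = inj₁ m
    ... | inj₂ (inj₁ m) = inj₂ m
    ... | inj₂ (inj₂ (_ , inj₁ g)) = contradiction g fi
    ... | inj₂ (inj₂ (_ , inj₂ g)) = contradiction g fj

    -- One red and one blue component own at most `γ + δ` vertices on both sides together.
    two-owners : ∀ x y →
      (∀ i → Free left i → Owned left red x i ⊎ Owned left blue y i) →
      (∀ j → Free right j → Owned right red x j ⊎ Owned right blue y j) → ⊥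
    two-owners x y f g = overfull C
      (≤-trans (free-cover C (owned? left red x ∪? owned? left blue y) (owned? right red x ∪? owned? right blue y) f g)
        (#-∪ (owned? left red x) (owned? left blue y) ⊕ #-∪ (owned? right red x) (owned? right blue y)))
      (bound {owned left red x} {owned left blue y} (cap-red x) (cap-blue y))
      where
      bound : ∀ {a b c d} → a + c ≤ γ → b + d ≤ δ → a + b + (c + d) ≤ γ + δ + (γ + δ)
      bound {a} {b} {c} {d} h₁ h₂ = begin
        a + b + (c + d) ≡⟨ solve (a ∷ b ∷ c ∷ d ∷ []) ⟩
        a + c + (b + d) ≤⟨ h₁ ⊕ h₂ ⟩
        γ + δ           ≤⟨ m≤m+n _ _ ⟩
        γ + δ + (γ + δ) ∎
        where open ≤-Reasoning

    -- The pivot case: red component `x` owns all free left vertices.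

    module Pivot (x : L) (pivot : ∀ i → Free left i → Owned left red x i) where

      Rest : Pred (Fin n) 0ℓ
      Rest i = ¬ Owned left red x i

      rest? : Decidable Rest
      rest? i = ¬? (owned? left red x i)

      rest-green : ∀ {i} → Rest i → Covered left green i
      rest-green {i} ri = decidable-stable (covered? left green i) (ri ∘ pivot i)

      -- The free right vertices that counting through `x` misses. The number of blue components
      -- they occupy decides the case.
      Residual : Pred (Fin n) 0ℓ
      Residual j = Free right j × label right red j ≡ x × ¬ Covered right red j

      residual? : Decidable Residual
      residual? j = free? right j ×-dec (label right red j ≟ x) ×-dec ¬? (covered? right red j)

      residual-blue : ∀ {j} → Residual j → Covered right blue j
      residual-blue {j} (fj , _ , ¬r) = [ (λ r → contradiction r ¬r) , id ]′ (free-right-covered C j fj)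

      -- A red meeting would be covered at its left end, the residual end being uncovered, and `x`
      -- would own that left end.
      rest-residual : ∀ {i j} → Rest i → Residual j →
        label left blue i ≡ label right blue j ⊎ label left green i ≡ label right green j
      rest-residual {i} {j} ri (_ , rx , ¬r) with spanned i j
      ... | inj₁ (_ , inj₂ r)       = contradiction r ¬r
      ... | inj₁ (e , inj₁ l)       = contradiction (l , trans e rx) ri
      ... | inj₂ (inj₁ (e , _))     = inj₁ e
      ... | inj₂ (inj₂ (e , _))     = inj₂ e

      -- Otherwise red `x` and green `y` own the whole left side, at most `γ + (γ + δ)` vertices.
      rest-not-monogreen : ∀ y → ¬ (∀ i → Rest i → label left green i ≡ y)
      rest-not-monogreen y f = overfull C
        (≤-trans (#-full (owned? left red x ∪? owned? left green y) all)
          (#-∪-≤ (owned? left red x) (owned? left green y) (owned≤ left red x) (owned≤ left green y)))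
        (+-monoˡ-≤ (γ + δ) (m≤m+n γ δ))
        where
        all : ∀ i → Owned left red x i ⊎ Owned left green y i
        all i with owned? left red x i
        ... | yes o = inj₁ o
        ... | no ri = inj₂ (rest-green ri , f i ri)

      -- A vertex of `Rest` shares a blue component with at most one of `j₁`, `j₂`, hence a green
      -- one with the other. So `Rest` splits into green components `g₁` and `g₂`; its part `Y` in
      -- `g₂` lies in blue component `b₁`.
      module Two {j₁ j₂} (res₁ : Residual j₁) (res₂ : Residual j₂)
                 (b₁≢b₂ : label right blue j₁ ≢ label right blue j₂) where

        b₁ = label right blue j₁
        b₂ = label right blue j₂
        g₁ = label right green j₁
        g₂ = label right green j₂

        g₁≢g₂ : g₁ ≢ g₂
        g₁≢g₂ eq = rest-not-monogreen g₁ mono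
          where
          mono : ∀ i → Rest i → label left green i ≡ g₁
          mono i ri with rest-residual ri res₁ | rest-residual ri res₂
          ... | inj₁ p | inj₁ q = contradiction (trans (sym p) q) b₁≢b₂
          ... | inj₁ _ | inj₂ q = trans q (sym eq)
          ... | inj₂ p | _      = p

        Y : Pred (Fin n) 0ℓ
        Y i = Rest i × label left green i ≡ g₂

        y? : Decidable Y
        y? i = rest? i ×-dec (label left green i ≟ g₂)

        Y-blue : ∀ {i} → Y i → label left blue i ≡ b₁
        Y-blue (ri , e) with rest-residual ri res₁
        ... | inj₁ p = p
        ... | inj₂ p = contradiction (trans (sym p) e) g₁≢g₂

        outside-Y : ∀ {i} → Rest i → label left green i ≢ g₂ → label left green i ≡ g₁
        outside-Y ri ne with rest-residual ri res₁ | rest-residual ri res₂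
        ... | inj₂ p | _      = p
        ... | inj₁ _ | inj₂ q = contradiction q ne
        ... | inj₁ p | inj₁ q = contradiction (trans (sym p) q) b₁≢b₂

        -- Red `x`, `Y` and green `g₁` exhaust the left side, and `g₁` owns at most `γ + δ` of it.
        Y-large : suc (γ + δ) ≤ owned left red x + # y?
        Y-large = cut {owned left red x} {# y?} large (≤-trans
          (#-full (owned? left red x ∪? y? ∪? owned? left green g₁) all)
          (#-∪-≤ (owned? left red x) (y? ∪? owned? left green g₁) ≤-refl
            (#-∪-≤ y? (owned? left green g₁) ≤-refl (owned≤ left green g₁))))
          where
          all : ∀ i → Owned left red x i ⊎ Y i ⊎ Owned left green g₁ i
          all i with owned? left red x i | label left green i ≟ g₂
          ... | yes o | _     = inj₁ o
          ... | no ri | yes e = inj₂ (inj₁ (ri , e))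
          ... | no ri | no ne  = inj₂ (inj₂ (rest-green ri , outside-Y ri ne))
          cut : ∀ {a y} → suc (γ + δ + (γ + δ)) ≤ n → n ≤ a + (y + (γ + δ)) → suc (γ + δ) ≤ a + y
          cut {a} {y} h₁ h₂ = +-cancelʳ-≤ (γ + δ) _ _
            (≤-trans h₁ (≤-trans h₂ (≤-reflexive (sym (+-assoc a y (γ + δ))))))

        Y-inhabited : ∃ Y
        Y-inhabited = inhabited y? (cut {owned left red x} Y-large (owned≤ left red x))
          where
          cut : ∀ {a y} → suc (γ + δ) ≤ a + y → a ≤ γ → 1 ≤ y
          cut {a} {zero} h₁ h₂ = contradiction (≤-trans h₁ (≤-trans (≤-reflexive (+-identityʳ a)) h₂)) (m+n≮m γ δ)
          cut {a} {suc y} _ _ = s≤s z≤n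

      module _ {j₁ j₂} (res₁ : Residual j₁) (res₂ : Residual j₂)
               (b₁≢b₂ : label right blue j₁ ≢ label right blue j₂) where
        private
          module T₁ = Two res₁ res₂ b₁≢b₂
          module T₂ = Two res₂ res₁ (b₁≢b₂ ∘ sym)

        -- Compare `j` with one vertex from each green part of `Rest`: it cannot share a green
        -- component with both, so it shares blue `b₁` or `b₂`.
        residual-two-labels : ∀ j → Residual j → Owned right blue T₁.b₁ j ⊎ Owned right blue T₁.b₂ j
        residual-two-labels j res
          with y₁ , Y₁ ← T₁.Y-inhabited | y₂ , Y₂ ← T₂.Y-inhabited
          with rest-residual (proj₁ Y₁) res | rest-residual (proj₁ Y₂) res
        ... | inj₁ p | _      = inj₁ (residual-blue res , trans (sym p) (T₁.Y-blue Y₁))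
        ... | inj₂ _ | inj₁ q = inj₂ (residual-blue res , trans (sym q) (T₂.Y-blue Y₂))
        ... | inj₂ p | inj₂ q = contradiction (trans (sym (proj₂ Y₂)) (trans q (trans (sym p) (proj₂ Y₁)))) T₁.g₁≢g₂

      -- The case of two residual vertices in distinct blue components other than `w`. With `small`,
      -- `Y-large` forces `Y` to have more than `γ` elements.
      module End (w : L) (cross : ∀ j → Free right j → label right red j ≡ x ⊎ label right blue j ≡ w)
                 (small : owned left red x ≤ δ) where

        Stray : Pred (Fin n) 0ℓ
        Stray t = Free right t × label right red t ≢ x

        stray? : Decidable Stray
        stray? t = free? right t ×-dec ¬? (label right red t ≟ x)

        module Half {j₁ j₂} (res₁ : Residual j₁) (res₂ : Residual j₂)
                    (b₁≢b₂ : label right blue j₁ ≢ label right blue j₂)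
                    (b₁≢w : label right blue j₁ ≢ w) where
          open Two res₁ res₂ b₁≢b₂ public

          r₁ : L
          r₁ = label left red (proj₁ Y-inhabited)

          -- Blue is excluded because `Y` lies in `b₁` and, by `cross`, the stray lies in `w`; green
          -- because `Y` lies in `g₂`.
          Y-stray : ∀ {i t} → Stray t → label right green t ≢ g₂ → Y i → Meets red i t
          Y-stray {i} {t} (ft , ≢x) ≢g Yi with spanned i t
          ... | inj₁ m = m
          ... | inj₂ (inj₁ (e , _)) = contradiction
            (trans (sym (Y-blue Yi)) (trans e ([ (λ ≡x → contradiction ≡x ≢x) , id ]′ (cross t ft)))) b₁≢w
          ... | inj₂ (inj₂ (e , _)) = contradiction (trans (sym e) (proj₂ Yi)) ≢g

          stray-owned : ∀ t → Stray t → label right green t ≢ g₂ → Owned right red r₁ t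
          stray-owned t st ≢g = decidable-stable (covered? right red t) ¬¬red
                              , sym (proj₁ (Y-stray st ≢g (proj₂ Y-inhabited)))
            where
            -- If the red cover missed `t`, the red component of `t` would own all of `Y`, more than
            -- `γ` vertices.
            ¬¬red : ¬ ¬ Covered right red t
            ¬¬red ¬r = clash 0 (Y-large ⊕ small ⊕ ≤-trans
                (#-mono y? (owned? left red (label right red t)) from-left) (owned≤ left red _))
              (rearrange (owned left red x) (# y?))
              where
              from-left : ∀ i → Y i → Owned left red (label right red t) i
              from-left i Yi with Y-stray st ≢g Yi
              ... | e , inj₁ l = l , e
              ... | _ , inj₂ r = contradiction r ¬r
              rearrange : ∀ a y → suc (γ + δ) + (a + y) ≡ suc (a + y + (δ + γ)) + 0
              rearrange a y = solve (a ∷ y ∷ γ ∷ δ ∷ [])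

          Y-red : ∀ {t} → Stray t → label right green t ≢ g₂ → ∀ {i} → Y i → label left red i ≡ r₁
          Y-red st ≢g Yi = trans (proj₁ (Y-stray st ≢g Yi)) (sym (proj₁ (Y-stray st ≢g (proj₂ Y-inhabited))))

          -- The stray `t` forces all of `Y` into red `r₁`. Each vertex of `Y` then meets `b` in
          -- blue `b₁` or red `r₁`; neither owns `b`, so the left end is covered.
          Y-small : ∀ {t} → Stray t → label right green t ≢ g₂ → ∀ b → label right green b ≢ g₂ →
            ¬ Owned right blue b₁ b → ¬ Owned right red r₁ b → # y? ≤ owned left blue b₁ + owned left red r₁
          Y-small st ≢g b b≢g ¬blue ¬red = ≤-trans
            (#-mono y? (owned? left blue b₁ ∪? owned? left red r₁) from-left)
            (#-∪ (owned? left blue b₁) (owned? left red r₁))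
            where
            from-left : ∀ i → Y i → Owned left blue b₁ i ⊎ Owned left red r₁ i
            from-left i Yi with spanned i b
            ... | inj₁ (e , inj₁ l) = inj₂ (l , Y-red st ≢g Yi)
            ... | inj₁ (e , inj₂ r) = contradiction (r , trans (sym e) (Y-red st ≢g Yi)) ¬red
            ... | inj₂ (inj₁ (e , inj₁ l)) = inj₁ (l , Y-blue Yi)
            ... | inj₂ (inj₁ (e , inj₂ r)) = contradiction (r , trans (sym e) (Y-blue Yi)) ¬blue
            ... | inj₂ (inj₂ (e , _)) = contradiction (trans (sym e) (proj₂ Yi)) b≢g

        module _ {j₁ j₂} (res₁ : Residual j₁) (res₂ : Residual j₂)
                 (b₁≢b₂ : label right blue j₁ ≢ label right blue j₂)
                 (b₁≢w : label right blue j₁ ≢ w) (b₂≢w : label right blue j₂ ≢ w) where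
          private
            module H₁ = Half res₁ res₂ b₁≢b₂ b₁≢w
            module H₂ = Half res₂ res₁ (b₁≢b₂ ∘ sym) b₂≢w
          open H₁ using (b₁; b₂; g₁; g₂; r₁; g₁≢g₂)
          open H₂ using () renaming (r₁ to r₂)

          free-right-owners : ∀ j → Free right j → ¬ Stray j →
            Owned right red x j ⊎ Owned right blue b₁ j ⊎ Owned right blue b₂ j
          free-right-owners j fj ¬st with label right red j ≟ x | covered? right red j
          ... | no ≢x  | _     = contradiction (fj , ≢x) ¬st
          ... | yes ≡x | yes r = inj₁ (r , ≡x)
          ... | yes ≡x | no ¬r = inj₂ (residual-two-labels res₁ res₂ b₁≢b₂ j (fj , ≡x , ¬r))

          Outside : Pred (Fin n) 0ℓ
          Outside = ∁ (Owned right blue b₁ ∪ Owned right blue b₂ ∪ Owned right red r₁ ∪ Owned right red r₂)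

          fourOwned? : Decidable (Owned right blue b₁ ∪ Owned right blue b₂ ∪ Owned right red r₁ ∪ Owned right red r₂)
          fourOwned? = owned? right blue b₁ ∪? owned? right blue b₂ ∪? owned? right red r₁ ∪? owned? right red r₂

          four-≤ : # fourOwned? ≤ owned right blue b₁ + (owned right blue b₂ + (owned right red r₁ + owned right red r₂))
          four-≤ = #-∪-≤ (owned? right blue b₁) (owned? right blue b₂ ∪? owned? right red r₁ ∪? owned? right red r₂) ≤-refl
            (#-∪-≤ (owned? right blue b₂) (owned? right red r₁ ∪? owned? right red r₂) ≤-refl
              (#-∪ (owned? right red r₁) (owned? right red r₂)))

          outside : ∃ Outside
          outside with Fin.any? (∁? fourOwned?)
          ... | yes o = o
          ... | no none = ⊥-elim (overfull C
            (≤-trans (#-full fourOwned? λ j → decidable-stable (fourOwned? j) (λ ¬o → none (j , ¬o))) four-≤)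
            (≤-trans (owned≤ right blue b₁ ⊕ owned≤ right blue b₂ ⊕ owned≤ right red r₁ ⊕ owned≤ right red r₂)
              (≤-reflexive regroup)))
            where
            regroup : δ + (δ + (γ + γ)) ≡ γ + δ + (γ + δ)
            regroup = solve (γ ∷ δ ∷ [])

          -- Otherwise red `x`, blue `b₁` and `b₂`, and red `r` own all free vertices; since `x`
          -- owns at most `γ` on both sides together, these are too few.
          stray-exists : ∀ g r → (∀ t → Stray t → label right green t ≡ g → Owned right red r t) →
            ∃ λ t → Stray t × label right green t ≢ g
          stray-exists g r f with Fin.any? (λ t → stray? t ×-dec ¬? (label right green t ≟ g))
          ... | yes found = found
          ... | no none = ⊥-elim (overfull C
            (≤-trans (free-cover C (owned? left red x)
                (owned? right red x ∪? owned? right blue b₁ ∪? owned? right blue b₂ ∪? owned? right red r)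
                pivot owners)
              (+-monoʳ-≤ (owned left red x)
                (#-∪-≤ (owned? right red x) (owned? right blue b₁ ∪? owned? right blue b₂ ∪? owned? right red r) ≤-refl
                  (#-∪-≤ (owned? right blue b₁) (owned? right blue b₂ ∪? owned? right red r) (owned≤ right blue b₁)
                    (#-∪-≤ (owned? right blue b₂) (owned? right red r) (owned≤ right blue b₂) (owned≤ right red r))))))
            (bound {owned left red x} (cap-red x)))
            where
            owners : ∀ j → Free right j → Owned right red x j ⊎ Owned right blue b₁ j ⊎ Owned right blue b₂ j ⊎ Owned right red r j
            owners j fj with stray? j
            ... | no ¬st = Sum.map₂ (Sum.map₂ inj₁) (free-right-owners j fj ¬st)
            ... | yes st with label right green j ≟ g
            ...   | yes e = inj₂ (inj₂ (inj₂ (f j st e)))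
            ...   | no ne  = contradiction (j , st , ne) none
            bound : ∀ {a b} → a + b ≤ γ → a + (b + (δ + (δ + γ))) ≤ γ + δ + (γ + δ)
            bound {a} {b} h = begin
              a + (b + (δ + (δ + γ))) ≡⟨ solve (a ∷ b ∷ γ ∷ δ ∷ []) ⟩
              a + b + (γ + δ + δ)     ≤⟨ +-monoˡ-≤ _ h ⟩
              γ + (γ + δ + δ)         ≡⟨ solve (γ ∷ δ ∷ []) ⟩
              γ + δ + (γ + δ)         ∎
              where open ≤-Reasoning

          -- A stray avoids `g₂` or `g₁`, so `stray-owned` places it in `r₁` or `r₂`.
          four-cover : n ≤ owned left red x + (owned right red x +
            (owned right blue b₁ + (owned right blue b₂ + (owned right red r₁ + owned right red r₂))))
          four-cover = ≤-trans
            (free-cover C (owned? left red x) (owned? right red x ∪? fourOwned?) pivot owners)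
            (+-monoʳ-≤ (owned left red x) (#-∪-≤ (owned? right red x) fourOwned? ≤-refl four-≤))
            where
            owners : ∀ j → Free right j → Owned right red x j ⊎ (Owned right blue b₁ ∪ Owned right blue b₂ ∪ Owned right red r₁ ∪ Owned right red r₂) j
            owners j fj with stray? j
            ... | no ¬st = Sum.map₂ (Sum.map₂ inj₁) (free-right-owners j fj ¬st)
            ... | yes st with label right green j ≟ g₂
            ...   | no ne  = inj₂ (inj₂ (inj₂ (inj₁ (H₁.stray-owned j st ne))))
            ...   | yes e = inj₂ (inj₂ (inj₂ (inj₂ (H₂.stray-owned j st λ e′ → g₁≢g₂ (trans (sym e′) e)))))

          -- By `four-cover` the four components own at least `γ + 2δ + 1` right vertices, so at
          -- most `γ − 1` left ones, while `y` is at least `γ + 1`. The gap of 2 is the `clash 1`.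
          Y-too-small : ∀ {y} → suc (γ + δ) ≤ owned left red x + y →
            y ≤ owned left blue b₁ + owned left blue b₂ + (owned left red r₁ + owned left red r₂) → ⊥
          Y-too-small = count {a = owned left red x} {a₁ = owned left blue b₁} {a₂ = owned left blue b₂}
            {e₁ = owned left red r₁} {e₂ = owned left red r₂} four-cover (cap-red x) (cap-blue b₁) (cap-blue b₂) (cap-red r₁) (cap-red r₂) small large
            where
            count : ∀ {n a b a₁ a₂ e₁ e₂ b₁ b₂ f₁ f₂ y} → n ≤ a + (b + (b₁ + (b₂ + (f₁ + f₂)))) →
              a + b ≤ γ → a₁ + b₁ ≤ δ → a₂ + b₂ ≤ δ → e₁ + f₁ ≤ γ → e₂ + f₂ ≤ γ → a ≤ δ →
              suc (γ + δ + (γ + δ)) ≤ n → suc (γ + δ) ≤ a + y → y ≤ a₁ + a₂ + (e₁ + e₂) → ⊥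
            count {n} {a} {b} {a₁} {a₂} {e₁} {e₂} {b₁} {b₂} {f₁} {f₂} {y} h₀ h₁ h₂ h₃ h₄ h₅ h₆ h₇ h₈ h₉ =
              clash 1 (h₀ ⊕ h₁ ⊕ h₂ ⊕ h₃ ⊕ h₄ ⊕ h₅ ⊕ h₆ ⊕ h₇ ⊕ h₈ ⊕ h₉)
                (solve (n ∷ a ∷ b ∷ a₁ ∷ a₂ ∷ e₁ ∷ e₂ ∷ b₁ ∷ b₂ ∷ f₁ ∷ f₂ ∷ y ∷ γ ∷ δ ∷ []))

          stray₁ : ∃ λ t → Stray t × label right green t ≢ g₂
          stray₁ = stray-exists g₂ r₂ λ t st e → H₂.stray-owned t st λ e′ → g₁≢g₂ (trans (sym e′) e)

          stray₂ : ∃ λ t → Stray t × label right green t ≢ g₁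
          stray₂ = stray-exists g₁ r₁ λ t st e → H₁.stray-owned t st λ e′ → g₁≢g₂ (trans (sym e) e′)

          -- Otherwise `Y-small` bounds this half of `Rest` by left vertices of `b₁` and `r₁`, which
          -- are too few. The other half gives `g₁` likewise.
          outside-g₂ : ∀ b → Outside b → label right green b ≡ g₂
          outside-g₂ b out = decidable-stable (label right green b ≟ g₂) λ ne → Y-too-small H₁.Y-large (≤-trans
            (H₁.Y-small (proj₁ (proj₂ stray₁)) (proj₂ (proj₂ stray₁)) b ne (out ∘ inj₁) (out ∘ inj₂ ∘ inj₂ ∘ inj₁))
            (m≤m+n (owned left blue b₁) (owned left blue b₂) ⊕ m≤m+n (owned left red r₁) (owned left red r₂)))

          outside-g₁ : ∀ b → Outside b → label right green b ≡ g₁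
          outside-g₁ b out = decidable-stable (label right green b ≟ g₁) λ ne → Y-too-small H₂.Y-large (≤-trans
            (H₂.Y-small (proj₁ (proj₂ stray₂)) (proj₂ (proj₂ stray₂)) b ne (out ∘ inj₂ ∘ inj₁) (out ∘ inj₂ ∘ inj₂ ∘ inj₂))
            (m≤n+m (owned left blue b₂) (owned left blue b₁) ⊕ m≤n+m (owned left red r₂) (owned left red r₁)))

          end : ⊥
          end = g₁≢g₂ (trans (sym (outside-g₁ _ (proj₂ outside))) (outside-g₂ _ (proj₂ outside)))

      Apart : L → Set
      Apart w = ∃ λ j₁ → ∃ λ j₂ → Residual j₁ × Residual j₂ × label right blue j₁ ≢ label right blue j₂ ×
        label right blue j₁ ≢ w × label right blue j₂ ≢ w

      -- If the residual vertices show at most one blue label besides `w`, then `v` is that label,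
      -- or `w` itself when there is none.
      apart-or-alike : ∀ w → Apart w ⊎ ∃ λ v → ∀ j → Residual j → Owned right blue v j ⊎ Owned right blue w j
      apart-or-alike w with Fin.any? (λ j → residual? j ×-dec ¬? (label right blue j ≟ w))
      ... | no none = inj₂ (w , λ j res → inj₂ (residual-blue res ,
              decidable-stable (label right blue j ≟ w) (λ ne → none (j , res , ne))))
      ... | yes (j₁ , res₁ , ≢₁)
        with Fin.any? (λ j → residual? j ×-dec ¬? (label right blue j ≟ w) ×-dec ¬? (label right blue j₁ ≟ label right blue j))
      ...   | yes (j₂ , res₂ , ≢₂ , ≢₁₂) = inj₁ (j₁ , j₂ , res₁ , res₂ , ≢₁₂ , ≢₁ , ≢₂)
      ...   | no none = inj₂ (label right blue j₁ , alike)
        where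
        alike : ∀ j → Residual j → Owned right blue (label right blue j₁) j ⊎ Owned right blue w j
        alike j res with label right blue j ≟ w
        ... | yes e = inj₂ (residual-blue res , e)
        ... | no ne  = inj₁ (residual-blue res ,
          sym (decidable-stable (label right blue j₁ ≟ label right blue j) (λ ≢₁ → none (j , res , ne , ≢₁))))

      pivot-or-residual : ∀ {j} → Free right j → label right red j ≡ x → Owned right red x j ⊎ Residual j
      pivot-or-residual {j} fj e with covered? right red j
      ... | yes r = inj₁ (r , e)
      ... | no ¬r = inj₂ (fj , e , ¬r)

      -- Two labels besides `w` lead to `End` if `γ ≤ δ`; if `δ ≤ γ`, the count is at most
      -- `γ + 3δ ≤ 2γ + 2δ`. With fewer labels it is at most `γ + 2δ`.
      one-sided : ∀ w → (∀ j → Free right j → label right red j ≢ x → Owned right blue w j) → ⊥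
      one-sided w off with apart-or-alike w
      ... | inj₁ (j₁ , j₂ , res₁ , res₂ , ≢₁₂ , ≢₁ , ≢₂) with ≤-total γ δ
      ...   | inj₁ γ≤δ = End.end w cross (≤-trans (owned≤ left red x) γ≤δ) res₁ res₂ ≢₁₂ ≢₁ ≢₂
        where
        cross : ∀ j → Free right j → label right red j ≡ x ⊎ label right blue j ≡ w
        cross j fj with label right red j ≟ x
        ... | yes e = inj₁ e
        ... | no ne  = inj₂ (proj₂ (off j fj ne))
      ...   | inj₂ δ≤γ = overfull C
        (≤-trans (free-cover C (owned? left red x)
            (owned? right red x ∪? owned? right blue b₁ ∪? owned? right blue b₂ ∪? owned? right blue w) pivot owners)
          (+-monoʳ-≤ (owned left red x)
            (#-∪-≤ (owned? right red x) (owned? right blue b₁ ∪? owned? right blue b₂ ∪? owned? right blue w) ≤-refl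
              (#-∪-≤ (owned? right blue b₁) (owned? right blue b₂ ∪? owned? right blue w) (owned≤ right blue b₁)
                (#-∪-≤ (owned? right blue b₂) (owned? right blue w) (owned≤ right blue b₂) (owned≤ right blue w))))))
        (bound {owned left red x} (cap-red x) δ≤γ)
        where
        b₁ = label right blue j₁
        b₂ = label right blue j₂
        owners : ∀ j → Free right j →
          Owned right red x j ⊎ Owned right blue b₁ j ⊎ Owned right blue b₂ j ⊎ Owned right blue w j
        owners j fj with label right red j ≟ x
        ... | no ne = inj₂ (inj₂ (inj₂ (off j fj ne)))
        ... | yes e = Sum.map₂ (Sum.map₂ inj₁ ∘ residual-two-labels res₁ res₂ ≢₁₂ j) (pivot-or-residual fj e)
        bound : ∀ {a b} → a + b ≤ γ → δ ≤ γ → a + (b + (δ + (δ + δ))) ≤ γ + δ + (γ + δ)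
        bound {a} {b} h h′ = begin
          a + (b + (δ + (δ + δ))) ≡⟨ solve (a ∷ b ∷ δ ∷ []) ⟩
          a + b + δ + (δ + δ)     ≤⟨ +-monoˡ-≤ δ h ⊕ +-monoˡ-≤ δ h′ ⟩
          γ + δ + (γ + δ)         ∎
          where open ≤-Reasoning
      one-sided w off | inj₂ (v , alike) = overfull C
        (≤-trans (free-cover C (owned? left red x)
            (owned? right red x ∪? owned? right blue v ∪? owned? right blue w) pivot owners)
          (+-monoʳ-≤ (owned left red x)
            (#-∪-≤ (owned? right red x) (owned? right blue v ∪? owned? right blue w) ≤-refl
              (#-∪-≤ (owned? right blue v) (owned? right blue w) (owned≤ right blue v) (owned≤ right blue w)))))
        (bound {owned left red x} (cap-red x))
        where
        owners : ∀ j → Free right j → Owned right red x j ⊎ Owned right blue v j ⊎ Owned right blue w j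
        owners j fj with label right red j ≟ x
        ... | no ne = inj₂ (inj₂ (off j fj ne))
        ... | yes e = Sum.map₂ (alike j) (pivot-or-residual fj e)
        bound : ∀ {a b} → a + b ≤ γ → a + (b + (δ + δ)) ≤ γ + δ + (γ + δ)
        bound {a} {b} h = begin
          a + (b + (δ + δ)) ≡⟨ solve (a ∷ b ∷ δ ∷ []) ⟩
          a + b + δ + δ     ≤⟨ +-monoˡ-≤ δ (+-monoˡ-≤ δ h) ⟩
          γ + δ + δ         ≤⟨ +-monoʳ-≤ (γ + δ) (m≤n+m δ γ) ⟩
          γ + δ + (γ + δ)   ∎
          where open ≤-Reasoning

  -- Free left vertices owned both by one red and by one blue component.

  module _ {γ δ : ℕ} (C : Config γ δ) where
    open Config C

    -- `End` applies in whichever colour has two extra labels; if neither has, the free vertices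
    -- number at most `2γ + 2δ`.
    two-sided-≤ : γ ≤ δ → ∀ x w → (∀ i → Free left i → Owned left red x i) → (∀ i → Free left i → Owned left blue w i) →
      (∀ j → Free right j → label right red j ≡ x ⊎ label right blue j ≡ w) → ⊥
    two-sided-≤ γ≤δ x w red-pivot blue-pivot cross with R.apart-or-alike w | B.apart-or-alike x
      where
      module R = Pivot C x red-pivot
      module B = Pivot (swapColours C) w blue-pivot
    ... | inj₁ (j₁ , j₂ , res₁ , res₂ , ≢₁₂ , ≢₁ , ≢₂) | _ =
      Pivot.End.end C x red-pivot w cross (≤-trans (owned≤ left red x) γ≤δ) res₁ res₂ ≢₁₂ ≢₁ ≢₂
    ... | inj₂ (v , alike) | inj₁ (j₁ , j₂ , res₁ , res₂ , ≢₁₂ , ≢₁ , ≢₂) =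
      Pivot.End.end (swapColours C) w blue-pivot x (λ j → Sum.swap ∘ cross j) small res₁ res₂ ≢₁₂ ≢₁ ≢₂
      where
      module R = Pivot C x red-pivot
      module B = Pivot (swapColours C) w blue-pivot
      r₁ = label right red j₁
      r₂ = label right red j₂
      owners : ∀ j → Free right j → Owned right red x j ⊎ Owned right blue v j ⊎ Owned right blue w j ⊎
        Owned right red r₁ j ⊎ Owned right red r₂ j
      owners j fj with cross j fj
      ... | inj₁ e = Sum.map₂ (Sum.map₂ inj₁ ∘ alike j) (R.pivot-or-residual fj e)
      ... | inj₂ e = inj₂ (inj₂ (Sum.map₂ (B.residual-two-labels res₁ res₂ ≢₁₂ j) (B.pivot-or-residual fj e)))
      -- With `d` right vertices owned by blue `w`, the free vertices number at most `3γ + δ + d`.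
      -- Hence `d > δ − γ`, and the cap `δ` of `w` leaves fewer than `γ` on the left.
      small : owned left blue w ≤ γ
      small = count {a = owned left red x} {c = owned left blue w}
        (≤-trans (free-cover C (owned? left red x)
            (owned? right red x ∪? owned? right blue v ∪? owned? right blue w ∪? owned? right red r₁ ∪? owned? right red r₂)
            red-pivot owners)
          (+-monoʳ-≤ (owned left red x)
            (#-∪-≤ (owned? right red x) (owned? right blue v ∪? owned? right blue w ∪? owned? right red r₁ ∪? owned? right red r₂) ≤-refl
              (#-∪-≤ (owned? right blue v) (owned? right blue w ∪? owned? right red r₁ ∪? owned? right red r₂) (owned≤ right blue v)
                (#-∪-≤ (owned? right blue w) (owned? right red r₁ ∪? owned? right red r₂) ≤-refl
                  (#-∪-≤ (owned? right red r₁) (owned? right red r₂) (owned≤ right red r₁) (owned≤ right red r₂)))))))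
        (cap-red x) (cap-blue w) large
        where
        count : ∀ {n a b c d} → n ≤ a + (b + (δ + (d + (γ + γ)))) → a + b ≤ γ → c + d ≤ δ →
          suc (γ + δ + (γ + δ)) ≤ n → c ≤ γ
        count {n} {a} {b} {c} {d} h₁ h₂ h₃ h₄ = ≤-trans (n≤1+n c)
          (+-cancelˡ-≤ (γ + δ + (γ + δ) + n + a + b + d) _ _ (begin
            γ + δ + (γ + δ) + n + a + b + d + suc c ≡⟨ solve (n ∷ a ∷ b ∷ c ∷ d ∷ γ ∷ δ ∷ []) ⟩
            n + (a + b + (c + d + suc (γ + δ + (γ + δ)))) ≤⟨ h₁ ⊕ h₂ ⊕ h₃ ⊕ h₄ ⟩
            a + (b + (δ + (d + (γ + γ)))) + (γ + (δ + n)) ≡⟨ solve (n ∷ a ∷ b ∷ d ∷ γ ∷ δ ∷ []) ⟩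
            γ + δ + (γ + δ) + n + a + b + d + γ ∎))
          where open ≤-Reasoning
    ... | inj₂ (v , alike) | inj₂ (v′ , alike′) = overfull C
      (≤-trans (free-cover C (owned? left red x)
          (owned? right red x ∪? owned? right blue v ∪? owned? right blue w ∪? owned? right red v′) red-pivot owners)
        (+-monoʳ-≤ (owned left red x)
          (#-∪-≤ (owned? right red x) (owned? right blue v ∪? owned? right blue w ∪? owned? right red v′) ≤-refl
            (#-∪-≤ (owned? right blue v) (owned? right blue w ∪? owned? right red v′) (owned≤ right blue v)
              (#-∪-≤ (owned? right blue w) (owned? right red v′) (owned≤ right blue w) (owned≤ right red v′))))))
      (bound {owned left red x} (cap-red x))
      where
      module R = Pivot C x red-pivot
      module B = Pivot (swapColours C) w blue-pivot
      owners : ∀ j → Free right j → Owned right red x j ⊎ Owned right blue v j ⊎ Owned right blue w j ⊎ Owned right red v′ j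
      owners j fj with cross j fj
      ... | inj₁ e = Sum.map₂ (Sum.map₂ inj₁ ∘ alike j) (R.pivot-or-residual fj e)
      ... | inj₂ e with B.pivot-or-residual fj e
      ...   | inj₁ o = inj₂ (inj₂ (inj₁ o))
      ...   | inj₂ res = [ inj₂ ∘ inj₂ ∘ inj₂ , inj₁ ]′ (alike′ j res)
      bound : ∀ {a b} → a + b ≤ γ → a + (b + (δ + (δ + γ))) ≤ γ + δ + (γ + δ)
      bound {a} {b} h = begin
        a + (b + (δ + (δ + γ))) ≡⟨ solve (a ∷ b ∷ γ ∷ δ ∷ []) ⟩
        a + b + (γ + δ + δ)     ≤⟨ +-monoˡ-≤ _ h ⟩
        γ + (γ + δ + δ)         ≡⟨ solve (γ ∷ δ ∷ []) ⟩
        γ + δ + (γ + δ)         ∎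
        where open ≤-Reasoning

  two-sided : ∀ {γ δ} (C : Config γ δ) → let open Config C in
    ∀ x w → (∀ i → Free left i → Owned left red x i) → (∀ i → Free left i → Owned left blue w i) →
    (∀ j → Free right j → label right red j ≡ x ⊎ label right blue j ≡ w) → ⊥
  two-sided {γ} {δ} C x w r b cross with ≤-total γ δ
  ... | inj₁ γ≤δ = two-sided-≤ C γ≤δ x w r b cross
  ... | inj₂ δ≤γ = two-sided-≤ (swapColours C) δ≤γ w x b r (λ j → Sum.swap ∘ cross j)

  -- Patterns of red and blue labels on the free vertices.

  module _ {γ δ : ℕ} (C : Config γ δ) where
    open Config C

    Monored : L → Set
    Monored x = (∀ i → Free left i → label left red i ≡ x) × (∀ j → Free right j → label right red j ≡ x)

    all-or-free : ∀ s {P : Pred (Fin n) 0ℓ} (P? : Decidable P) →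
      (∀ i → Free s i → P i) ⊎ ∃ λ i → Free s i × ¬ P i
    all-or-free s P? with Fin.any? (λ i → free? s i ×-dec ¬? (P? i))
    ... | yes found = inj₂ found
    ... | no none = inj₁ λ i fi → decidable-stable (P? i) (λ ¬p → none (i , fi , ¬p))

  -- If `x` owns neither side's free vertices entirely, those missed by the red cover meet across
  -- only in blue, so they share one blue component and `two-owners` applies.
  monored-⊥ : ∀ {γ δ} (C : Config γ δ) x → ¬ Monored C x
  monored-⊥ C x (ml , mr)
    with all-or-free C left (Config.owned? C left red x) | all-or-free C right (Config.owned? C right red x)
  -- The second `x` is an arbitrary blue label: no free right vertex lies outside red `x`.
  ... | inj₁ pivot | _ = Pivot.one-sided C x pivot x λ j fj ne → contradiction (mr j fj) ne
  ... | inj₂ _ | inj₁ pivot = Pivot.one-sided (swapSides C) x pivot x λ i fi ne → contradiction (ml i fi) ne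
  ... | inj₂ (i , fi , ¬i) | inj₂ (j , fj , ¬j) = two-owners C x (label left blue i) lefts rights
    where
    open Config C
    blue-only : ∀ {i j} → Free left i → Free right j → ¬ Covered left red i → ¬ Covered right red j →
      label left blue i ≡ label right blue j
    blue-only fi fj ¬l ¬r with free-edge C fi fj
    ... | inj₁ (_ , inj₁ l) = contradiction l ¬l
    ... | inj₁ (_ , inj₂ r) = contradiction r ¬r
    ... | inj₂ (e , _) = e
    ¬i-red : ¬ Covered left red i
    ¬i-red l = ¬i (l , ml i fi)
    ¬j-red : ¬ Covered right red j
    ¬j-red r = ¬j (r , mr j fj)
    lefts : ∀ i′ → Free left i′ → Owned left red x i′ ⊎ Owned left blue (label left blue i) i′
    lefts i′ fi′ with covered? left red i′ | free-left-covered C i′ fi′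
    ... | yes l | _      = inj₁ (l , ml i′ fi′)
    ... | no ¬l | inj₁ l = contradiction l ¬l
    ... | no ¬l | inj₂ b = inj₂ (b , trans (blue-only fi′ fj ¬l ¬j-red) (sym (blue-only fi fj ¬i-red ¬j-red)))
    rights : ∀ j′ → Free right j′ → Owned right red x j′ ⊎ Owned right blue (label left blue i) j′
    rights j′ fj′ with covered? right red j′ | free-right-covered C j′ fj′
    ... | yes r | _      = inj₁ (r , mr j′ fj′)
    ... | no ¬r | inj₁ r = contradiction r ¬r
    ... | no ¬r | inj₂ b = inj₂ (b , sym (blue-only fi fj′ ¬i-red ¬r))

  module _ {γ δ : ℕ} (C : Config γ δ) (x y : L) where
    open Config C

    SingleLeft : Set
    SingleLeft = ∀ i → Free left i → label left red i ≡ x × label left blue i ≡ y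

    -- The blue cover misses `i`, so a free right vertex outside red `x` meets `i` in blue and must
    -- be covered itself.
    forced-right : SingleLeft → ∀ {i} → Free left i → ¬ Owned left blue y i →
      ∀ j → Free right j → label right red j ≢ x → Owned right blue y j
    forced-right single {i} fi ¬b j fj ne with free-edge C fi fj
    ... | inj₁ (e , _) = contradiction (trans (sym e) (proj₁ (single i fi))) ne
    ... | inj₂ (e , inj₁ l) = contradiction (l , proj₂ (single i fi)) ¬b
    ... | inj₂ (e , inj₂ r) = r , trans (sym e) (proj₂ (single i fi))

  single-left-⊥ : ∀ {γ δ} (C : Config γ δ) {x y} → ∃ (Config.Free C left) → ¬ SingleLeft C x y
  single-left-⊥ C {x} {y} (i₀ , fi₀) single
    with all-or-free C left (Config.owned? C left red x) | all-or-free C left (Config.owned? C left blue y)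
  ... | inj₁ r | inj₁ b = two-sided C x y r b λ j fj →
    Sum.map (λ m → trans (sym (proj₁ m)) (proj₁ (single i₀ fi₀)))
            (λ m → trans (sym (proj₁ m)) (proj₂ (single i₀ fi₀))) (free-edge C fi₀ fj)
  ... | inj₁ r | inj₂ (i , fi , ¬b) = Pivot.one-sided C x r y (forced-right C x y single fi ¬b)
  ... | inj₂ (i , fi , ¬r) | inj₁ b = Pivot.one-sided (swapColours C) y b x
    (forced-right (swapColours C) y x (λ i fi → swap (single i fi)) fi ¬r)
  ... | inj₂ (i , fi , ¬r) | inj₂ (i′ , fi′ , ¬b) = two-owners C x y lefts rights
    where
    open Config C
    lefts : ∀ i → Free left i → Owned left red x i ⊎ Owned left blue y i
    lefts i fi = Sum.map (_, proj₁ (single i fi)) (_, proj₂ (single i fi)) (free-left-covered C i fi)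
    rights : ∀ j → Free right j → Owned right red x j ⊎ Owned right blue y j
    rights j fj with label right red j ≟ x | label right blue j ≟ y
    ... | no ne | _     = inj₂ (forced-right C x y single fi′ ¬b j fj ne)
    ... | yes _ | no ne = inj₁ (forced-right (swapColours C) y x (λ i fi → swap (single i fi)) fi ¬r j fj ne)
    ... | yes p | yes q = Sum.map (_, p) (_, q) (free-right-covered C j fj)

  module _ {γ δ : ℕ} (C : Config γ δ) where
    open Config C

    four-labels-⊥ : ∀ r₀ r₁ b₀ b₁ →
      (∀ s i → Free s i → (label s red i ≡ r₀ ⊎ label s red i ≡ r₁) × (label s blue i ≡ b₀ ⊎ label s blue i ≡ b₁)) → ⊥
    four-labels-⊥ r₀ r₁ b₀ b₁ f = overfull C
      (≤-trans (free-cover C (four? left) (four? right)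
          (λ i fi → owners left i (f left i fi) (free-left-covered C i fi))
          (λ j fj → owners right j (f right j fj) (free-right-covered C j fj)))
        (four-≤ left ⊕ four-≤ right))
      (bound {owned left red r₀} {b = owned left red r₁} {c = owned left blue b₀} {d = owned left blue b₁}
        (cap-red r₀) (cap-red r₁) (cap-blue b₀) (cap-blue b₁))
      where
      Four : Side → Pred (Fin n) 0ℓ
      Four s = Owned s red r₀ ∪ Owned s red r₁ ∪ Owned s blue b₀ ∪ Owned s blue b₁
      four? : ∀ s → Decidable (Four s)
      four? s = owned? s red r₀ ∪? owned? s red r₁ ∪? owned? s blue b₀ ∪? owned? s blue b₁
      four-≤ : ∀ s → # (four? s) ≤ owned s red r₀ + (owned s red r₁ + (owned s blue b₀ + owned s blue b₁))
      four-≤ s = #-∪-≤ (owned? s red r₀) (owned? s red r₁ ∪? owned? s blue b₀ ∪? owned? s blue b₁) ≤-refl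
        (#-∪-≤ (owned? s red r₁) (owned? s blue b₀ ∪? owned? s blue b₁) ≤-refl
          (#-∪ (owned? s blue b₀) (owned? s blue b₁)))
      owners : ∀ s i → (label s red i ≡ r₀ ⊎ label s red i ≡ r₁) × (label s blue i ≡ b₀ ⊎ label s blue i ≡ b₁) →
        Covered s red i ⊎ Covered s blue i → Four s i
      owners s i (inj₁ e , _) (inj₁ r) = inj₁ (r , e)
      owners s i (inj₂ e , _) (inj₁ r) = inj₂ (inj₁ (r , e))
      owners s i (_ , inj₁ e) (inj₂ b) = inj₂ (inj₂ (inj₁ (b , e)))
      owners s i (_ , inj₂ e) (inj₂ b) = inj₂ (inj₂ (inj₂ (b , e)))
      bound : ∀ {a a′ b b′ c c′ d d′} → a + a′ ≤ γ → b + b′ ≤ γ → c + c′ ≤ δ → d + d′ ≤ δ →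
        a + (b + (c + d)) + (a′ + (b′ + (c′ + d′))) ≤ γ + δ + (γ + δ)
      bound {a} {a′} {b} {b′} {c} {c′} {d} {d′} h₁ h₂ h₃ h₄ = begin
        a + (b + (c + d)) + (a′ + (b′ + (c′ + d′)))
          ≡⟨ solve (a ∷ a′ ∷ b ∷ b′ ∷ c ∷ c′ ∷ d ∷ d′ ∷ []) ⟩
        a + a′ + (b + b′ + (c + c′ + (d + d′))) ≤⟨ h₁ ⊕ h₂ ⊕ h₃ ⊕ h₄ ⟩
        γ + (γ + (δ + δ))                       ≡⟨ solve (γ ∷ δ ∷ []) ⟩
        γ + δ + (γ + δ)                         ∎
        where open ≤-Reasoning

    module _ {i₀ i₁} (fi₀ : Free left i₀) (fi₁ : Free left i₁)
             (blue≢ : label left blue i₀ ≢ label left blue i₁) where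

      -- No right vertex can share a blue component with both `i₀` and `i₁`, so it meets one of them
      -- in red.
      shared-red : label left red i₀ ≡ label left red i₁ → ∀ j → Free right j → label right red j ≡ label left red i₀
      shared-red e j fj with free-edge C fi₀ fj | free-edge C fi₁ fj
      ... | inj₁ (p , _) | _ = sym p
      ... | inj₂ _ | inj₁ (q , _) = trans (sym q) (sym e)
      ... | inj₂ (p , _) | inj₂ (q , _) = contradiction (trans p (sym q)) blue≢

      Corner : L → L → Fin n → Set
      Corner r b j = label right red j ≡ r × label right blue j ≡ b

      corners : label left red i₀ ≢ label left red i₁ → ∀ j → Free right j →
        Corner (label left red i₀) (label left blue i₁) j ⊎ Corner (label left red i₁) (label left blue i₀) j
      corners red≢ j fj with free-edge C fi₀ fj | free-edge C fi₁ fj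
      ... | inj₁ (p , _) | inj₁ (q , _) = contradiction (trans p (sym q)) red≢
      ... | inj₁ (p , _) | inj₂ (q , _) = inj₁ (sym p , sym q)
      ... | inj₂ (p , _) | inj₁ (q , _) = inj₂ (sym q , sym p)
      ... | inj₂ (p , _) | inj₂ (q , _) = contradiction (trans p (sym q)) blue≢

    Alike : Side → Fin n → Fin n → Set
    Alike s i j = label s red i ≡ label s red j × label s blue i ≡ label s blue j

    alike? : ∀ s i j → Dec (Alike s i j)
    alike? s i j = (label s red i ≟ label s red j) ×-dec (label s blue i ≟ label s blue j)

  -- `shared-red` makes `j₀` and `j₁` agree in red, so they differ in blue; the same argument from
  -- the right then makes the left side red-constant.
  shared-red-⊥ : ∀ {γ δ} (C : Config γ δ) → let open Config C in
    ∀ {i₀ i₁ j₀ j₁} → Free left i₀ → Free left i₁ → Free right j₀ → Free right j₁ →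
    label left red i₀ ≡ label left red i₁ → label left blue i₀ ≢ label left blue i₁ → ¬ Alike C right j₀ j₁ → ⊥
  shared-red-⊥ C {i₀} {i₁} {j₀} {j₁} fi₀ fi₁ fj₀ fj₁ e ne ¬alike =
    monored-⊥ C (label left red i₀) (lefts , rights)
    where
    open Config C
    rights : ∀ j → Free right j → label right red j ≡ label left red i₀
    rights = shared-red C fi₀ fi₁ ne e
    e′ : label right red j₀ ≡ label right red j₁
    e′ = trans (rights j₀ fj₀) (sym (rights j₁ fj₁))
    lefts : ∀ i → Free left i → label left red i ≡ label left red i₀
    lefts i fi = trans (shared-red (swapSides C) fj₀ fj₁ (λ b → ¬alike (e′ , b)) e′ i fi) (rights j₀ fj₀)

  -- Unlike right vertices occupy opposite corners, hence differ in both labels and confine the left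
  -- side in turn; two red and two blue components remain.
  corners-⊥ : ∀ {γ δ} (C : Config γ δ) → let open Config C in
    ∀ {i₀ i₁ j₀ j₁} → Free left i₀ → Free left i₁ → Free right j₀ → Free right j₁ →
    label left red i₀ ≢ label left red i₁ → label left blue i₀ ≢ label left blue i₁ → ¬ Alike C right j₀ j₁ → ⊥
  corners-⊥ C {i₀} {i₁} {j₀} {j₁} fi₀ fi₁ fj₀ fj₁ red≢ blue≢ ¬alike =
    four-labels-⊥ C r₀ r₁ b₀ b₁ λ { left → lefts ; right → rights }
    where
    open Config C
    r₀ = label left red i₀
    r₁ = label left red i₁
    b₀ = label left blue i₀
    b₁ = label left blue i₁
    corner : ∀ j → Free right j → Corner C fi₀ fi₁ blue≢ r₀ b₁ j ⊎ Corner C fi₀ fi₁ blue≢ r₁ b₀ j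
    corner = corners C fi₀ fi₁ blue≢ red≢
    rights : ∀ j → Free right j → (label right red j ≡ r₀ ⊎ label right red j ≡ r₁) ×
      (label right blue j ≡ b₀ ⊎ label right blue j ≡ b₁)
    rights j fj with corner j fj
    ... | inj₁ (p , q) = inj₁ p , inj₂ q
    ... | inj₂ (p , q) = inj₂ p , inj₁ q
    distinct : label right red j₀ ≢ label right red j₁ × label right blue j₀ ≢ label right blue j₁
    distinct with corner j₀ fj₀ | corner j₁ fj₁
    ... | inj₁ (p , q) | inj₁ (p′ , q′) = contradiction (trans p (sym p′) , trans q (sym q′)) ¬alike
    ... | inj₂ (p , q) | inj₂ (p′ , q′) = contradiction (trans p (sym p′) , trans q (sym q′)) ¬alike
    ... | inj₁ (p , q) | inj₂ (p′ , q′) =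
      (λ e → red≢ (trans (sym p) (trans e p′))) , (λ e → blue≢ (trans (sym q′) (trans (sym e) q)))
    ... | inj₂ (p , q) | inj₁ (p′ , q′) =
      (λ e → red≢ (trans (sym p′) (trans (sym e) p))) , (λ e → blue≢ (trans (sym q) (trans e q′)))
    lefts : ∀ i → Free left i → (label left red i ≡ r₀ ⊎ label left red i ≡ r₁) ×
      (label left blue i ≡ b₀ ⊎ label left blue i ≡ b₁)
    lefts i fi with corners (swapSides C) fj₀ fj₁ (proj₂ distinct) (proj₁ distinct) i fi
    ... | inj₁ (p , q) = Sum.map (trans p) (trans p) (proj₁ (rights j₀ fj₀))
                       , Sum.map (trans q) (trans q) (proj₂ (rights j₁ fj₁))
    ... | inj₂ (p , q) = Sum.map (trans p) (trans p) (proj₁ (rights j₁ fj₁))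
                       , Sum.map (trans q) (trans q) (proj₂ (rights j₀ fj₀))

  no-config : ∀ {γ δ} (C : Config γ δ) → ∃ (Config.Free C left) → ∃ (Config.Free C right) → ⊥
  no-config C (i₀ , fi₀) (j₀ , fj₀) with all-or-free C left (alike? C left i₀) | all-or-free C right (alike? C right j₀)
  ... | inj₁ same | _ = single-left-⊥ C (i₀ , fi₀) λ i fi → sym (proj₁ (same i fi)) , sym (proj₂ (same i fi))
  ... | inj₂ _ | inj₁ same =
    single-left-⊥ (swapSides C) (j₀ , fj₀) λ j fj → sym (proj₁ (same j fj)) , sym (proj₂ (same j fj))
  ... | inj₂ (i₁ , fi₁ , ¬i) | inj₂ (j₁ , fj₁ , ¬j)
    with label left red i₀ ≟ label left red i₁ | label left blue i₀ ≟ label left blue i₁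
    where open Config C
  ...   | yes r | yes b = ¬i (r , b)
  ...   | yes r | no ¬b = shared-red-⊥ C fi₀ fi₁ fj₀ fj₁ r ¬b ¬j
  ...   | no ¬r | yes b = shared-red-⊥ (swapColours C) fi₀ fi₁ fj₀ fj₁ b ¬r (¬j ∘ swap)
  ...   | no ¬r | no ¬b = corners-⊥ C fi₀ fi₁ fj₀ fj₁ ¬r ¬b ¬j

-- Upper bound: from colourings to configurations.

open BoundedCover
open ComponentLabels

module _ (p q n : ℕ) (n-large : suc (p + q + (p + q)) ≤ n) (col : Colouring n) where

  private
    Λ : ∀ c → ComponentLabels col c
    Λ c = componentLabels col c

    κ : Colour → ℕ
    κ red   = p
    κ blue  = q
    κ green = p + q

    module _ (K : ∀ c → BoundedCover col c (Λ c) (κ c)) where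

      config : Covers.Config _≟ᵛ_ {n} p q
      config = record
        { label = λ { left c → label (Λ c) ∘ inj₁ ; right c → label (Λ c) ∘ inj₂ }
        ; Covered = λ { left c → Left (K c) ; right c → Right (K c) }
        ; covered? = λ { left c → left? (K c) ; right c → right? (K c) }
        ; spanned = λ i j → by-colour i j (col i j) refl
        ; cap-red = bounded (K red)
        ; cap-blue = bounded (K blue)
        ; cap-green = bounded (K green)
        ; large = n-large
        ; free-size = count {a = # (left? (K green))} {# (∁? (left? (K green)))} {# (right? (K green))} {# (∁? (right? (K green)))}
            (#-∁-≥ (left? (K green))) (#-∁-≥ (right? (K green))) (total (K green))
        }
        where
        Meeting : Colour → Fin n → Fin n → Set
        Meeting c i j = label (Λ c) (inj₁ i) ≡ label (Λ c) (inj₂ j) × (Left (K c) i ⊎ Right (K c) j)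
        by-colour : ∀ i j c → col i j ≡ c → Meeting red i j ⊎ Meeting blue i j ⊎ Meeting green i j
        by-colour i j red   e = inj₁ (joined (Λ red) i j e , covers (K red) i j e)
        by-colour i j blue  e = inj₂ (inj₁ (joined (Λ blue) i j e , covers (K blue) i j e))
        by-colour i j green e = inj₂ (inj₂ (joined (Λ green) i j e , covers (K green) i j e))
        count : ∀ {a b c d} → n ≤ a + b → n ≤ c + d → a + c ≤ n → n ≤ b + d
        count {a} {b} {c} {d} h₁ h₂ h₃ = +-cancelˡ-≤ (n + (a + c)) _ _ (begin
          n + (a + c) + n     ≡⟨ solve (n ∷ a ∷ c ∷ []) ⟩
          n + (n + (a + c))   ≤⟨ h₁ ⊕ h₂ ⊕ h₃ ⟩
          a + b + (c + d + n) ≡⟨ solve (n ∷ a ∷ b ∷ c ∷ d ∷ []) ⟩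
          n + (a + c) + (b + d) ∎)
          where open ≤-Reasoning

  conn-matching-exists : HasConnMatching col red (suc p) ⊎ HasConnMatching col blue (suc q) ⊎
    HasConnMatching col green (suc (p + q))
  conn-matching-exists
    with conn-matching-or-cover col red (Λ red) p (≤-trans (s≤s (≤-trans (m≤m+n p q) (m≤m+n (p + q) _))) n-large)
       | conn-matching-or-cover col blue (Λ blue) q (≤-trans (s≤s (≤-trans (m≤n+m q p) (m≤m+n (p + q) _))) n-large)
       | conn-matching-or-cover col green (Λ green) (p + q) (≤-trans (s≤s (m≤m+n (p + q) _)) n-large)
  ... | inj₁ m | _ | _ = inj₁ m
  ... | inj₂ _ | inj₁ m | _ = inj₂ (inj₁ m)
  ... | inj₂ _ | inj₂ _ | inj₁ m = inj₂ (inj₂ m)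
  ... | inj₂ (Kr , _) | inj₂ (Kb , _) | inj₂ (Kg , free-left , free-right) =
    ⊥-elim (Covers.no-config _≟ᵛ_ (config λ { red → Kr ; blue → Kb ; green → Kg }) free-left free-right)

-- Lower bound: the block colouring.

data LeftBlock : Set where
  X Y H : LeftBlock

data RightBlock : Set where
  Q₀ Q₁ P₀ P₁ : RightBlock

blockColour : LeftBlock → RightBlock → Colour
blockColour X Q₀ = blue
blockColour X Q₁ = green
blockColour X P₀ = red
blockColour X P₁ = green
blockColour Y Q₀ = green
blockColour Y Q₁ = blue
blockColour Y P₀ = green
blockColour Y P₁ = red
blockColour H Q₀ = red
blockColour H Q₁ = red
blockColour H P₀ = blue
blockColour H P₁ = blue

-- Every column of blockColour is a bijection, so a colour and a right block determine
-- the left block, and left blocks are constant along monochromatic paths.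
neighbour : Colour → RightBlock → LeftBlock
neighbour red   Q₀ = H
neighbour red   Q₁ = H
neighbour red   P₀ = X
neighbour red   P₁ = Y
neighbour blue  Q₀ = X
neighbour blue  Q₁ = Y
neighbour blue  P₀ = H
neighbour blue  P₁ = H
neighbour green Q₀ = Y
neighbour green Q₁ = X
neighbour green P₀ = Y
neighbour green P₁ = X

neighbour-colour : ∀ x r → neighbour (blockColour x r) r ≡ x
neighbour-colour X Q₀ = refl
neighbour-colour X Q₁ = refl
neighbour-colour X P₀ = refl
neighbour-colour X P₁ = refl
neighbour-colour Y Q₀ = refl
neighbour-colour Y Q₁ = refl
neighbour-colour Y P₀ = refl
neighbour-colour Y P₁ = refl
neighbour-colour H Q₀ = refl
neighbour-colour H Q₁ = refl
neighbour-colour H P₀ = refl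
neighbour-colour H P₁ = refl

interval-≤ : ∀ {t n} (f : Fin t → Fin n) → Injective _≡_ _≡_ f → ∀ a w →
  (∀ i → a ≤ Fin.toℕ (f i) × Fin.toℕ (f i) < a + w) → t ≤ w
interval-≤ f f-inj a w within = Fin.injective⇒≤ {f = shift} shift-inj
  where
  below : ∀ i → Fin.toℕ (f i) ∸ a < w
  below i with lo , hi ← within i = +-cancelˡ-< a _ _ (subst (_< a + w) (sym (m+[n∸m]≡n lo)) hi)
  shift : Fin _ → Fin w
  shift i = Fin.fromℕ< (below i)
  shift-inj : Injective _≡_ _≡_ shift
  shift-inj {i} {j} eq = f-inj (Fin.toℕ-injective (∸-cancelʳ-≡ (proj₁ (within i)) (proj₁ (within j))
    (trans (sym (Fin.toℕ-fromℕ< (below i))) (trans (cong Fin.toℕ eq) (Fin.toℕ-fromℕ< (below j))))))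

module BlockColouring (p q g n : ℕ) (p≤q : p ≤ q) (n≤right : n ≤ q + q + p + p) (n≤left : n ≤ g + g + p) where

  leftBlock : ℕ → LeftBlock
  leftBlock i with i <? g | i <? g + g
  ... | yes _ | _     = X
  ... | no _  | yes _ = Y
  ... | no _  | no _  = H

  rightBlock : ℕ → RightBlock
  rightBlock j with j <? q | j <? q + q | j <? q + q + p
  ... | yes _ | _     | _     = Q₀
  ... | no _  | yes _ | _     = Q₁
  ... | no _  | no _  | yes _ = P₀
  ... | no _  | no _  | no _  = P₁

  Within : ℕ → ℕ → ℕ → Set
  Within a w i = a ≤ i × i < a + w

  LeftSpan : LeftBlock → ℕ → Set
  LeftSpan X = Within 0 g
  LeftSpan Y = Within g g
  LeftSpan H = Within (g + g) p

  RightSpan : RightBlock → ℕ → Set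
  RightSpan Q₀ = Within 0 q
  RightSpan Q₁ = Within q q
  RightSpan P₀ = Within (q + q) p
  RightSpan P₁ = Within (q + q + p) p

  left-span : ∀ i → i < n → LeftSpan (leftBlock i) i
  left-span i i<n with i <? g | i <? g + g
  ... | yes h | _      = z≤n , h
  ... | no h  | yes h′ = ≮⇒≥ h , h′
  ... | no h  | no h′  = ≮⇒≥ h′ , <-≤-trans i<n n≤left

  right-span : ∀ j → j < n → RightSpan (rightBlock j) j
  right-span j j<n with j <? q | j <? q + q | j <? q + q + p
  ... | yes h | _      | _      = z≤n , h
  ... | no h  | yes h′ | _      = ≮⇒≥ h , h′
  ... | no h  | no h′  | yes h″ = ≮⇒≥ h′ , h″
  ... | no h  | no h′  | no h″  = ≮⇒≥ h″ , <-≤-trans j<n n≤right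

  lb : Fin n → LeftBlock
  lb = leftBlock ∘ Fin.toℕ

  rb : Fin n → RightBlock
  rb = rightBlock ∘ Fin.toℕ

  colouring : Colouring n
  colouring i j = blockColour (lb i) (rb j)

  block : Colour → Vertex n → LeftBlock
  block c (inj₁ i) = lb i
  block c (inj₂ j) = neighbour c (rb j)

  connected⇒same-block : ∀ {c u v} → Connected colouring c u v → block c u ≡ block c v
  connected⇒same-block ε = refl
  connected⇒same-block (lr {i} {j} refl ◅ path) = trans (sym (neighbour-colour (lb i) (rb j))) (connected⇒same-block path)
  connected⇒same-block (rl {i} {j} refl ◅ path) = trans (neighbour-colour (lb i) (rb j)) (connected⇒same-block path)

  bound : Colour → ℕ
  bound red   = p
  bound blue  = q
  bound green = g

  -- The smaller end bounds the matching: the left block for `H` in red and blue and for `X`, `Y` in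
  -- green; for `X`, `Y` in red and blue, the only right block of that colour.
  block-matching-≤ : ∀ {t} c x (f h : Fin t → Fin n) → Injective _≡_ _≡_ f → Injective _≡_ _≡_ h →
    (∀ i → lb (f i) ≡ x) → (∀ i → colouring (f i) (h i) ≡ c) → t ≤ bound c
  block-matching-≤ {t} c x f h f-inj h-inj in-x coloured = bounded-by c x in-x coloured′
    where
    coloured′ : ∀ i → blockColour x (rb (h i)) ≡ c
    coloured′ i = trans (cong (λ y → blockColour y (rb (h i))) (sym (in-x i))) (coloured i)
    from-left : ∀ {x} a w → (∀ {i} → LeftSpan x i → Within a w i) → (∀ i → lb (f i) ≡ x) → t ≤ w
    from-left a w span in-x = interval-≤ f f-inj a w λ i →
      span (subst (λ x → LeftSpan x (Fin.toℕ (f i))) (in-x i) (left-span _ (Fin.toℕ<n (f i))))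
    from-right : ∀ {x c} r a w → (∀ {j} → RightSpan r j → Within a w j) → (∀ r′ → blockColour x r′ ≡ c → r′ ≡ r) →
      (∀ i → blockColour x (rb (h i)) ≡ c) → t ≤ w
    from-right r a w span only coloured = interval-≤ h h-inj a w λ i →
      span (subst (λ r → RightSpan r (Fin.toℕ (h i))) (only _ (coloured i)) (right-span _ (Fin.toℕ<n (h i))))
    bounded-by : ∀ c x → (∀ i → lb (f i) ≡ x) → (∀ i → blockColour x (rb (h i)) ≡ c) → t ≤ bound c
    bounded-by red   X _ cl = from-right P₀ (q + q) p id (λ { P₀ refl → refl }) cl
    bounded-by red   Y _ cl = from-right P₁ (q + q + p) p id (λ { P₁ refl → refl }) cl
    bounded-by red   H in-x _ = from-left (g + g) p id in-x
    bounded-by blue  X _ cl = from-right Q₀ 0 q id (λ { Q₀ refl → refl }) cl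
    bounded-by blue  Y _ cl = from-right Q₁ q q id (λ { Q₁ refl → refl }) cl
    bounded-by blue  H in-x _ = ≤-trans (from-left (g + g) p id in-x) p≤q
    bounded-by green X in-x _ = from-left 0 g id in-x
    bounded-by green Y in-x _ = from-left g g id in-x
    -- No green edge leaves `H`, so every index is absurd and any interval serves.
    bounded-by green H _ cl = interval-≤ f f-inj 0 g λ i → ⊥-elim (never (rb (h i)) (cl i))
      where
      never : ∀ r → blockColour H r ≢ green
      never Q₀ ()
      never Q₁ ()
      never P₀ ()
      never P₁ ()

  no-conn-matching : ∀ c → ¬ HasConnMatching colouring c (suc (bound c))
  no-conn-matching c (f , h , f-inj , h-inj , coloured , conn) = <-irrefl refl
    (block-matching-≤ c (lb (f zero)) f h f-inj h-inj (λ i → connected⇒same-block (conn i zero)) coloured)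

-- Combining the two bounds.

HasConnMatching-≤ : ∀ {n} {col : Colouring n} {c s t} → s ≤ t → HasConnMatching col c t → HasConnMatching col c s
HasConnMatching-≤ s≤t (f , g , f-inj , g-inj , coloured , conn) =
  f ∘ ι , g ∘ ι , ι-inj ∘ f-inj , ι-inj ∘ g-inj , coloured ∘ ι , λ i j → conn (ι i) (ι j)
  where
  ι = λ i → Fin.inject≤ i s≤t
  ι-inj : Injective _≡_ _≡_ ι
  ι-inj = Fin.inject≤-injective s≤t s≤t _ _

theorem4p2 : (k l m : ℕ) → 3 ≤ k → k < l →
    2 * l + k ∸ 1 < 2 * m → m < k + l ∸ 1 →
    IsR k l m (2 * k + 2 * l ∸ 3)
theorem4p2 (suc p) (suc q) zero _ _ ()
theorem4p2 (suc p) (suc q) (suc g) _ k<l lower upper =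
  subst (IsR (suc p) (suc q) (suc g)) (sym order) (ramsey , λ n n<N R → avoid n (≤-pred n<N) R)
  where
  open ≤-Reasoning
  order : 2 * suc p + 2 * suc q ∸ 3 ≡ suc (p + q + (p + q))
  order = cong (_∸ 3) expand
    where
    expand : 2 * suc p + 2 * suc q ≡ 3 + suc (p + q + (p + q))
    expand = solve (p ∷ q ∷ [])
  g≤p+q : suc g ≤ suc (p + q)
  g≤p+q = ≤-trans (n≤1+n _) (≤-trans upper (≤-reflexive (+-suc p q)))
  ramsey : RamseyProp (suc p) (suc q) (suc g) (suc (p + q + (p + q)))
  -- The green size obtained is `k + l − 1`; as `m` is smaller, the matching restricts to size `m`.
  ramsey col = Sum.map₂ (Sum.map₂ (HasConnMatching-≤ g≤p+q)) (conn-matching-exists p q _ ≤-refl col)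
  -- The lower bound on `m` enters here: left blocks of sizes `g`, `g`, `p` have room for `2(p + q)`
  -- vertices.
  room : q + q + p ≤ g + g
  room = +-cancelˡ-≤ 3 _ _ (begin
    3 + (q + q + p)           ≡⟨ cong suc (cong (_∸ 1) expand) ⟩
    suc (2 * suc q + suc p ∸ 1) ≤⟨ lower ⟩
    2 * suc g                 ≤⟨ n≤1+n _ ⟩
    suc (2 * suc g)           ≡⟨ solve (g ∷ []) ⟩
    3 + (g + g)               ∎)
    where
    expand : 3 + (q + q + p) ≡ 2 * suc q + suc p
    expand = solve (p ∷ q ∷ [])
  -- Each `n` up to `2(p + q)` gets its own colouring, with the blocks cut off at `n`.
  avoid : ∀ n → n ≤ p + q + (p + q) → ¬ RamseyProp (suc p) (suc q) (suc g) n
  avoid n n≤ R = [ no-conn-matching red , [ no-conn-matching blue , no-conn-matching green ]′ ]′ (R colouring)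
    where
    n≤right : n ≤ q + q + p + p
    n≤right = ≤-trans n≤ (≤-reflexive (regroup p q))
      where
      regroup : ∀ p q → p + q + (p + q) ≡ q + q + p + p
      regroup p q = solve (p ∷ q ∷ [])
    open BlockColouring p q g n (≤-pred (<⇒≤ k<l)) n≤right (≤-trans n≤right (+-monoˡ-≤ p room))
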